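{- There exists an algorithm for the ordinal matroid secretary problem (on arbitrary matroids) that is $\frac{1}{1-\ln 2}=\frac{1}{\ln(e/2)}$ intersection-competitive, i.e., $\mathbb{E}[|\mathrm{OPT}\cap\mathrm{ALG}|]\ge \ln(e/2)\,|\mathrm{OPT}|$.
   Context: Ordinal MSP: $\mathcal{M}=(R,\mathcal{I})$ is a matroid with $|R|=n$ and rank $\rho$, $\succ$ a total order on $R$. For $Q\subseteq R$, $\mathrm{OPT}(Q)$ is the greedy (lexicographically maximum w.r.t. $\succ$) base of $Q$ and $\mathrm{OPT}=\mathrm{OPT}(R)$. Elements arrive in uniformly random order $r_1,\dots,r_n$; the algorithm knows $n$, can only compare revealed elements under $\succ$ and query independence of sets of revealed elements, and must irrevocably accept or reject each element on arrival keeping the accepted set $\mathrm{ALG}$ independent. An algorithm is $\alpha$ intersection-competitive if $\mathbb{E}[|\mathrm{OPT}\cap\mathrm{ALG}|]\ge|\mathrm{OPT}|/\alpha$. -}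

module Defs where

open import Data.Bool using (Bool; true; false; T; if_then_else_; _∧_; _∨_; not)
open import Data.Nat as ℕ using (ℕ; zero; suc; _+_; _*_; _^_; _<ᵇ_)
open import Data.Nat.Properties using (m*n≢0; m^n≢0)
open import Data.Fin as Fin using (Fin; toℕ; inject≤)
open import Data.Fin.Subset using (Subset; ⊥; ⁅_⁆; _∪_; _∩_; _⊆_; _∈_; _∉_; ∣_∣)
open import Data.Fin.Permutation using (Permutation′; _⟨$⟩ʳ_; _⟨$⟩ˡ_)
open import Data.List as List using (List; []; _∷_; foldr; concatMap; filter; length)
open import Data.Vec as Vec using (Vec; lookup; tabulate)
open import Data.Product using (Σ; ∃-syntax; _×_)
open import Data.Integer using (+_)
open import Data.Rational as ℚ using (ℚ; _/_; 0ℚ; 1ℚ)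
open import Relation.Nullary.Decidable using (⌊_⌋)
open import Relation.Binary.PropositionalEquality using (_≡_)

allB : {m : ℕ} → (Fin m → Bool) → Bool
allB {zero}  f = true
allB {suc m} f = f Fin.zero ∧ allB (λ i → f (Fin.suc i))

anyB : {m : ℕ} → (Fin m → Bool) → Bool
anyB {zero}  f = false
anyB {suc m} f = f Fin.zero ∨ anyB (λ i → f (Fin.suc i))

_=ᶠ_ : {m : ℕ} → Fin m → Fin m → Bool
i =ᶠ j = ⌊ i Fin.≟ j ⌋

image : {m n : ℕ} → (Fin m → Fin n) → Subset m → Subset n
image {m} f S = tabulate (λ e → anyB (λ k → lookup S k ∧ (f k =ᶠ e)))

record Matroid (n : ℕ) : Set where
  field
    indep     : Subset n → Bool
    indep-∅   : T (indep ⊥)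
    indep-⊆   : ∀ {A B} → A ⊆ B → T (indep B) → T (indep A)
    indep-aug : ∀ {A B} → T (indep A) → T (indep B) → ∣ A ∣ ℕ.< ∣ B ∣ →
                ∃[ x ] (x ∈ B × x ∉ A × T (indep (⁅ x ⁆ ∪ A)))
open Matroid public

-- The total order ≻ on R = Fin n is given by a permutation π:
--   x ≻ y  iff  toℕ (π x) > toℕ (π y)   (larger π-value = better).

_≻[_]_ : {n : ℕ} → Fin n → Permutation′ n → Fin n → Bool
x ≻[ π ] y = toℕ (π ⟨$⟩ʳ y) <ᵇ toℕ (π ⟨$⟩ʳ x)

-- OPT = OPT(R): the greedy base, scanning elements from best to worst
-- (foldr over ranks 0..n-1 processes rank n-1, the best, first).
OPT : {n : ℕ} → Matroid n → Permutation′ n → Subset n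
OPT {n} M π = foldr step ⊥ (List.allFin n)
  where
  step : Fin n → Subset n → Subset n
  step r S = let x = π ⟨$⟩ˡ r in
             if indep M (⁅ x ⁆ ∪ S) then ⁅ x ⁆ ∪ S else S

-- Online algorithms in the ordinal (comparison + independence oracle)
-- model, possibly randomized with a finite uniform seed space.
--
-- When the element at arrival step i (0-based) arrives, the algorithm
-- knows n, its random seed, and only the "view" of the revealed
-- elements r_0..r_i, indexed by arrival position k : Fin (suc i):
--   * cmp k l = true  iff  r_k ≻ r_l,
--   * ind S   = true  iff  {r_k : k ∈ S} is independent.
-- It outputs whether to accept r_i.  (Its own earlier decisions are
-- recomputable from restrictions of this view, so need not be passed.)

record Algorithm : Set where
  field
    seeds  : ℕ → ℕ   -- for size n the seed is uniform on Fin (suc (seeds n))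
    decide : (n : ℕ) → Fin (suc (seeds n)) → (i : Fin n) →
             (Fin (suc (toℕ i)) → Fin (suc (toℕ i)) → Bool) →
             (Subset (suc (toℕ i)) → Bool) → Bool
open Algorithm public

-- Arrival order σ : Fin n → Fin n, σ k = r_k.
-- The prefix r_0..r_i as a map from arrival positions.
prefix : {n : ℕ} → (Fin n → Fin n) → (i : Fin n) → Fin (suc (toℕ i)) → Fin n
prefix σ i k = σ (inject≤ k (Data.Fin.Properties.toℕ<n i))
  where import Data.Fin.Properties

ALG : (A : Algorithm) {n : ℕ} → Matroid n → Permutation′ n →
      Fin (suc (seeds A n)) → (Fin n → Fin n) → Subset n
ALG A {n} M π s σ = image σ (tabulate accepted)
  where
  accepted : Fin n → Bool
  accepted i = decide A n s i
                 (λ k l → prefix σ i k ≻[ π ] prefix σ i l)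
                 (λ S → indep M (image (prefix σ i) S))

allVecs : (n k : ℕ) → List (Vec (Fin n) k)
allVecs n zero    = Vec.[] ∷ []
allVecs n (suc k) = concatMap (λ x → List.map (x Vec.∷_) (allVecs n k)) (List.allFin n)

injectiveB : {n : ℕ} → Vec (Fin n) n → Bool
injectiveB v = allB (λ i → allB (λ j → not (lookup v i =ᶠ lookup v j) ∨ (i =ᶠ j)))

arrivalOrders : (n : ℕ) → List (Vec (Fin n) n)
arrivalOrders n = filter (λ v → T? (injectiveB v)) (allVecs n n)
  where open import Relation.Nullary.Decidable using () renaming (T? to T?)

sumL : List ℕ → ℕ
sumL = foldr _+_ 0

totalHits : (A : Algorithm) {n : ℕ} → Matroid n → Permutation′ n → ℕ
totalHits A {n} M π =
  sumL (List.map (λ s → sumL (List.map (λ v → ∣ OPT M π ∩ ALG A M π s (lookup v) ∣)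
                                       (arrivalOrders n)))
                 (List.allFin (suc (seeds A n))))

sampleSize : (A : Algorithm) → ℕ → ℕ
sampleSize A n = suc (seeds A n) * length (arrivalOrders n)

Feasible : Algorithm → Set
Feasible A = ∀ n (M : Matroid n) (π : Permutation′ n) (s : Fin (suc (seeds A n)))
               (σ : Fin n → Fin n) → (∀ {i j} → σ i ≡ σ j → i ≡ j) →
               T (indep M (ALG A M π s σ))

-- ln 2 = Σ_{j ≥ 1} 1 / (j 2^j).  lnTwoUpper K is the partial sum up to K
-- plus the tail bound 1/((K+1) 2^K); it decreases to ln 2 and is ≥ ln 2.
-- Hence, for rational x:   x ≥ 1 - ln 2  ⇔  ∀ K, x ≥ 1 - lnTwoUpper K.

lnTwoTerm : ℕ → ℚ
lnTwoTerm j = _/_ (+ 1) (suc j * 2 ^ suc j)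
  {{m*n≢0 (suc j) (2 ^ suc j) {{_}} {{m^n≢0 2 (suc j)}}}}

lnTwoPartial : ℕ → ℚ
lnTwoPartial zero    = 0ℚ
lnTwoPartial (suc K) = lnTwoPartial K ℚ.+ lnTwoTerm K

lnTwoUpper : ℕ → ℚ
lnTwoUpper K = lnTwoPartial K ℚ.+ _/_ (+ 1) (suc K * 2 ^ K)
  {{m*n≢0 (suc K) (2 ^ K) {{_}} {{m^n≢0 2 K}}}}

{-# OPTIONS --safe #-}
-- The algorithm observes the first ⌊n/2⌋ arrivals and afterwards accepts r_i if it is improving
-- (r_i ∈ OPT(R_i)) and not spanned by the earlier improving elements after the observation phase.
-- Let I be the set of improving elements after that phase and O ⊆ I the elements of OPT in it.
-- The accepted set is a base of I, hence has at least ∣ O ∣ elements, so at most ∣ I \ O ∣ elements of O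
-- are lost: 2 ∣ O ∣ ≤ ∣ OPT ∩ ALG ∣ + ∣ I ∣.  On average ∣ O ∣ is ρ (n - ⌊n/2⌋) / n, and since r_i is
-- improving with probability at most ρ / i, ∣ I ∣ is at most ρ (H_n - H_⌊n/2⌋), where essentially
-- H_2k - H_k ≤ ln 2.  That bound is obtained against the series Σ 1 / (j 2^j) by iterating
-- 1 / (2k - i) = 1 / 2k + (i / 2k) / (2k - i).
module Submission where

open import Defs
open import Data.Bool using (Bool; true; false; T; if_then_else_; _∧_; _∨_; not)
open import Data.Bool.Properties using (T?; T-∧; T-∨; T-≡)
open import Data.Empty using (⊥-elim)
open import Data.Fin as Fin using (Fin; toℕ; zero; suc; _↑ʳ_; _↑ˡ_)
open import Data.Fin.Permutation using (Permutation′; _⟨$⟩ʳ_; _⟨$⟩ˡ_; inverseˡ; inverseʳ; permutation)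
import Data.Fin.Properties as Fin
open import Data.Fin.Subset using (Subset; ⊥; ⁅_⁆; _∪_; _∩_; _⊆_; _∈_; _∉_; ∁; ∣_∣)
open import Data.Fin.Subset.Properties
import Data.Integer as ℤ
import Data.Integer.Properties as ℤ
open import Data.List as List using (List; []; _∷_; foldr; concatMap; filter; length)
import Data.List.Membership.Propositional as List
open import Data.List.Membership.Propositional.Properties using (∈-allFin; ∈-filter⁻)
import Data.List.Relation.Unary.All as All
open import Data.List.Relation.Unary.AllPairs using (AllPairs; []; _∷_)
import Data.List.Relation.Unary.AllPairs.Properties as AllPairs
open import Data.List.Relation.Unary.Any using (here; there)
open import Data.Nat as ℕ using (ℕ; zero; suc; _+_; _*_; _∸_; _^_; _≤_; _<_; _<ᵇ_; z≤n; s≤s; ⌊_/2⌋; NonZero)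
import Data.Nat.Properties as ℕ
open import Data.Nat.Tactic.RingSolver using (solve-∀)
open import Data.Product using (∃-syntax; _×_; _,_; proj₁; proj₂; map₂)
open import Data.Rational as ℚ using (ℚ; _/_; 0ℚ; 1ℚ)
import Data.Rational.Properties as ℚ
open import Data.Rational.Unnormalised as ℚᵘ using (mkℚᵘ)
import Data.Rational.Unnormalised.Properties as ℚᵘ
open import Data.Sum using (_⊎_; inj₁; inj₂; [_,_]′)
open import Data.Unit using (⊤; tt)
open import Data.Vec as Vec using (Vec; lookup; tabulate; []; _∷_)
import Data.Vec.Properties as Vec
open import Algebra.Properties.CommutativeMonoid.Sum ℕ.+-0-commutativeMonoid
  using (sum; sum-cong-≗; ∑-distrib-+; ∑-comm; sum-permute; sum-init-last)
open import Algebra.Properties.CommutativeSemigroup ℕ.+-commutativeSemigroup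
  using () renaming (interchange to +-interchange)
open import Algebra.Properties.Semiring.Sum ℕ.+-*-semiring using (*-distribˡ-sum)
open import Function using (_∘_; id; _⇔_; Equivalence; mk⇔)
open import Function.Definitions using (Injective)
open import Relation.Binary.PropositionalEquality
  using (_≡_; _≢_; refl; sym; trans; cong; cong₂; subst; subst₂; module ≡-Reasoning)
open import Relation.Nullary using (¬_; Dec; yes; no; contradiction)
open import Relation.Nullary.Decidable using (⌊_⌋; toWitness; fromWitness; _×-dec_; _→-dec_; ¬?; decidable-stable)

open Equivalence using (to; from)

-- One half is the best sampling fraction for this analysis: with fraction p the two averages leave
-- 2 (1 - p) - ln (1/p) per element of OPT, which is largest at p = 1/2, with value 1 - ln 2. `OPT`,
-- the accepted set and the improving elements of a fixed prefix are all greedy selections, for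
-- different keys and ground sets, so one theory of `Sel` serves the three. Being spanned is tested
-- against every independent subset (`Unspanned`) and not against a rank or a chosen base; this
-- makes the condition antitone in the set tested against and easy to carry from arrival positions
-- to elements. Expectations are kept as integer totals over all arrival orders, and uniformity
-- enters only as invariance under swapping neighbouring arrivals. The bound is claimed for every n
-- without an error term, so rounding must cost nothing: for odd n the extra late position pays
-- exactly for its own improving element.

private variable
  m n : ℕ
  A B : Set

-- Greedy bases from the independence oracle

∈⇔T : {S : Subset n} {x : Fin n} → x ∈ S ⇔ T (lookup S x)
∈⇔T {S = S} {x} = mk⇔ (from T-≡ ∘ Vec.[]=⇒lookup) (Vec.lookup⇒[]= x S ∘ to T-≡)

∈-tabulate : {f : Fin n → Bool} {x : Fin n} → x ∈ tabulate f ⇔ T (f x)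
∈-tabulate {f = f} {x} = mk⇔
  (λ x∈ → subst T (Vec.lookup∘tabulate f x) (to ∈⇔T x∈))
  (λ t → from ∈⇔T (subst T (sym (Vec.lookup∘tabulate f x)) t))

x∈⁅x⁆∪S : {x : Fin n} (S : Subset n) → x ∈ ⁅ x ⁆ ∪ S
x∈⁅x⁆∪S {x = x} S = x∈p∪q⁺ (inj₁ (x∈⁅x⁆ x))

∈-insert⁻ : {x y : Fin n} (S : Subset n) → y ∈ ⁅ x ⁆ ∪ S → y ≡ x ⊎ y ∈ S
∈-insert⁻ {x = x} S y∈ with x∈p∪q⁻ ⁅ x ⁆ S y∈
... | inj₁ y∈x = inj₁ (x∈⁅y⁆⇒x≡y x y∈x)
... | inj₂ y∈S = inj₂ y∈S

insert-⊆ : {x : Fin n} {S U : Subset n} → x ∈ U → S ⊆ U → ⁅ x ⁆ ∪ S ⊆ U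
insert-⊆ {S = S} x∈U S⊆U y∈ with ∈-insert⁻ S y∈
... | inj₁ refl = x∈U
... | inj₂ y∈S = S⊆U y∈S

insert-mono : {x : Fin n} {S U : Subset n} → S ⊆ U → ⁅ x ⁆ ∪ S ⊆ ⁅ x ⁆ ∪ U
insert-mono {x = x} {U = U} S⊆U = insert-⊆ (x∈⁅x⁆∪S U) (λ y∈S → q⊆p∪q ⁅ x ⁆ U (S⊆U y∈S))

∣insert∣ : {x : Fin n} {S : Subset n} → x ∉ S → ∣ S ∣ < ∣ ⁅ x ⁆ ∪ S ∣
∣insert∣ {x = x} {S} x∉S = p⊂q⇒∣p∣<∣q∣ (q⊆p∪q ⁅ x ⁆ S , x , x∈⁅x⁆∪S S , x∉S)

-- Unspanned ind P x says that x lies outside the closure of P, in terms of the independence oracle.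
Unspanned : (Subset n → Bool) → (Fin n → Set) → Fin n → Set
Unspanned ind P x = ∀ S → (∀ {y} → y ∈ S → P y) → T (ind S) → T (ind (⁅ x ⁆ ∪ S))

Unspanned-antitone : {ind : Subset n → Bool} {P Q : Fin n → Set} {x : Fin n} →
                     (∀ {y} → P y → Q y) → Unspanned ind Q x → Unspanned ind P x
Unspanned-antitone P⇒Q free S S⊆P = free S (P⇒Q ∘ S⊆P)

module Greedy (M : Matroid n) where

  Indep : Subset n → Set
  Indep S = T (indep M S)

  Free : (Fin n → Set) → Fin n → Set
  Free = Unspanned (indep M)

  -- Testing one maximal set `B` suffices. An independent `S` as large as `⁅ x ⁆ ∪ B` would augment
  -- `B` inside `P`, against maximality. A smaller `S` is augmented from `⁅ x ⁆ ∪ B`: either by `x`,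
  -- as wanted, or by an element of `B`, after which the larger set is treated the same way. The
  -- fuel `k` bounds the size still missing.
  maximal-free : ∀ {P : Fin n → Set} {x} (B : Subset n) → (∀ {y} → y ∈ B → P y) →
                 (∀ {y} → P y → y ∉ B → ¬ Indep (⁅ y ⁆ ∪ B)) →
                 x ∉ B → Indep (⁅ x ⁆ ∪ B) → Free P x
  maximal-free {P} {x} B B⊆P maximal x∉B indep-xB S = grow ∣ ⁅ x ⁆ ∪ B ∣ S (ℕ.m≤n+m _ ∣ S ∣)
    where
    grow : ∀ k (S : Subset n) → ∣ ⁅ x ⁆ ∪ B ∣ ≤ ∣ S ∣ + k → (∀ {y} → y ∈ S → P y) →
           Indep S → Indep (⁅ x ⁆ ∪ S)
    grow k S size S⊆P indep-S with ∣ S ∣ ℕ.<? ∣ ⁅ x ⁆ ∪ B ∣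
    grow k S size S⊆P indep-S | no ≮ with indep-aug M (indep-⊆ M (q⊆p∪q ⁅ x ⁆ B) indep-xB) indep-S
                                            (ℕ.<-≤-trans (∣insert∣ x∉B) (ℕ.≮⇒≥ ≮))
    ... | y , y∈S , y∉B , indep-yB = contradiction indep-yB (maximal (S⊆P y∈S) y∉B)
    grow k S size S⊆P indep-S | yes small with indep-aug M indep-S indep-xB small
    ... | y , y∈xB , y∉S , indep-yS with ∈-insert⁻ B y∈xB
    ...   | inj₁ refl = indep-yS
    grow zero S size _ _ | yes small | _ | inj₂ _ =
      contradiction (ℕ.≤-trans size (ℕ.≤-reflexive (ℕ.+-identityʳ _))) (ℕ.<⇒≱ small)
    grow (suc k) S size S⊆P _ | yes _ | y , _ , y∉S , indep-yS | inj₂ y∈B =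
      indep-⊆ M (insert-mono (q⊆p∪q ⁅ y ⁆ S))
        (grow k (⁅ y ⁆ ∪ S) size′ yS⊆P indep-yS)
      where
      size′ : ∣ ⁅ x ⁆ ∪ B ∣ ≤ ∣ ⁅ y ⁆ ∪ S ∣ + k
      size′ = ℕ.≤-trans size (ℕ.≤-trans (ℕ.≤-reflexive (ℕ.+-suc _ k)) (ℕ.+-monoˡ-≤ k (∣insert∣ y∉S)))
      yS⊆P : ∀ {z} → z ∈ ⁅ y ⁆ ∪ S → P z
      yS⊆P z∈ with ∈-insert⁻ S z∈
      ... | inj₁ refl = B⊆P y∈B
      ... | inj₂ z∈S = S⊆P z∈S

  -- The greedy rule that scans P by increasing key and keeps what is not spanned by what came before.
  Sel : (Fin n → Fin n) → (Fin n → Set) → Fin n → Set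
  Sel key P x = P x × Free (λ y → P y × key y Fin.< key x) x

  module _ {key : Fin n → Fin n} where

    -- Take out the element with the largest key. By injectivity all others have strictly smaller
    -- keys, so they form an independent set of earlier elements, and freeness of the last one
    -- restores it.
    Sel-indep : ∀ {P} → Injective _≡_ _≡_ key →
                (S : Subset n) → (∀ {x} → x ∈ S → Sel key P x) → Indep S
    Sel-indep {P} key-injective S = below n S (λ {x} _ → Fin.toℕ<n (key x))
      where
      below : ∀ t (S : Subset n) → (∀ {x} → x ∈ S → toℕ (key x) < t) →
              (∀ {x} → x ∈ S → Sel key P x) → Indep S
      below zero S S<t _ = indep-⊆ M (λ x∈S → contradiction (S<t x∈S) λ ()) (indep-∅ M)
      below (suc t) S S<t S⊆Sel with Fin.any? (λ x → (x ∈? S) ×-dec (toℕ (key x) ℕ.≟ t))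
      ... | no none = below t S
              (λ x∈S → ℕ.≤∧≢⇒< (ℕ.s≤s⁻¹ (S<t x∈S)) (λ eq → none (_ , x∈S , eq))) S⊆Sel
      ... | yes (x , x∈S , kx≡t) =
              indep-⊆ M S⊆ (proj₂ (S⊆Sel x∈S) S₀ earlier (below t S₀ lower (S⊆Sel ∘ old)))
        where
        S₀ : Subset n
        S₀ = S ∩ ∁ ⁅ x ⁆
        old : S₀ ⊆ S
        old = p∩q⊆p S (∁ ⁅ x ⁆)
        lower : ∀ {y} → y ∈ S₀ → toℕ (key y) < t
        lower {y} y∈ = ℕ.≤∧≢⇒< (ℕ.s≤s⁻¹ (S<t (old y∈))) λ ky≡t →
          x∉⁅y⁆⇒x≢y (x∈∁p⇒x∉p (p∩q⊆q S (∁ ⁅ x ⁆) y∈))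
            (key-injective (Fin.toℕ-injective (trans ky≡t (sym kx≡t))))
        earlier : ∀ {y} → y ∈ S₀ → P y × key y Fin.< key x
        earlier y∈ = proj₁ (S⊆Sel (old y∈)) , subst (_ <_) (sym kx≡t) (lower y∈)
        S⊆ : S ⊆ ⁅ x ⁆ ∪ S₀
        S⊆ {y} y∈S with y Fin.≟ x
        ... | yes refl = x∈⁅x⁆∪S S₀
        ... | no y≢x = q⊆p∪q ⁅ x ⁆ S₀ (x∈p∩q⁺ (y∈S , x∉p⇒x∈∁p (x≢y⇒x∉⁅y⁆ y≢x)))

    module _ {P} {S : Subset n} (S⇔Sel : ∀ {x} → x ∈ S ⇔ Sel key P x) where

      -- Independence from the chosen elements has to be lifted to freeness from all earlier
      -- elements of `P`. By `maximal-free` it is enough that the chosen elements before `x` are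
      -- maximal among the elements of `P` before `x`. This is the same claim for smaller keys,
      -- hence the induction on the key in `free`.
      Sel-complete : ∀ {x} → P x → Indep (⁅ x ⁆ ∪ S) → x ∈ S
      Sel-complete Px indep-xS = from S⇔Sel
        (Px , free n _ (Fin.toℕ<n _) (indep-⊆ M (insert-mono (p∩q⊆p S _)) indep-xS))
        where
        earlier? : Fin n → Fin n → Bool
        earlier? x y = ⌊ key y Fin.<? key x ⌋
        S< : Fin n → Subset n
        S< x = S ∩ tabulate (earlier? x)
        ∈S<⁻ : ∀ {x y} → y ∈ S< x → y ∈ S × key y Fin.< key x
        ∈S<⁻ {x} y∈ with x∈p∩q⁻ S (tabulate (earlier? x)) y∈
        ... | y∈S , y∈t = y∈S , toWitness (to ∈-tabulate y∈t)
        ∈S<⁺ : ∀ {x y} → y ∈ S → key y Fin.< key x → y ∈ S< x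
        ∈S<⁺ y∈S y<x = x∈p∩q⁺ (y∈S , from ∈-tabulate (fromWitness y<x))
        free : ∀ t x → toℕ (key x) < t → Indep (⁅ x ⁆ ∪ S< x) → Free (λ y → P y × key y Fin.< key x) x
        free (suc t) x x<t indep = maximal-free (S< x)
          (λ y∈ → proj₁ (to S⇔Sel (proj₁ (∈S<⁻ y∈))) , proj₂ (∈S<⁻ y∈))
          (λ { {y} (Py , y<x) y∉ indep-y → y∉ (∈S<⁺ (from S⇔Sel (Py ,
               free t y (ℕ.<-≤-trans y<x (ℕ.s≤s⁻¹ x<t))
                 (indep-⊆ M (insert-mono (λ z∈ → ∈S<⁺ (proj₁ (∈S<⁻ z∈)) (Fin.<-trans (proj₂ (∈S<⁻ z∈)) y<x))) indep-y)))
               y<x) })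
          (λ x∈ → ℕ.<-irrefl refl (proj₂ (∈S<⁻ x∈)))
          indep

      Sel-maximum : Injective _≡_ _≡_ key → (J : Subset n) → (∀ {x} → x ∈ J → P x) → Indep J → ∣ J ∣ ≤ ∣ S ∣
      Sel-maximum key-injective J J⊆P indep-J with ∣ S ∣ ℕ.<? ∣ J ∣
      ... | no ≮ = ℕ.≮⇒≥ ≮
      ... | yes < with indep-aug M (Sel-indep key-injective S (to S⇔Sel)) indep-J <
      ...   | y , y∈J , y∉S , indep-yS = contradiction (Sel-complete (J⊆P y∈J) indep-yS) y∉S

-- The total order as a scanning key, and `OPT` as a greedy selection

betterFirst : Permutation′ n → Fin n → Fin n
betterFirst π x = Fin.opposite (π ⟨$⟩ʳ x)

betterFirst-injective : (π : Permutation′ n) → Injective _≡_ _≡_ (betterFirst π)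
betterFirst-injective π {x} {y} eq = trans (sym (inverseˡ π)) (trans (cong (π ⟨$⟩ˡ_)
  (trans (sym (Fin.opposite-involutive _)) (trans (cong Fin.opposite eq) (Fin.opposite-involutive _)))) (inverseˡ π))

≻⇔< : (π : Permutation′ n) {x y : Fin n} → T (y ≻[ π ] x) ⇔ betterFirst π y Fin.< betterFirst π x
≻⇔< {n} π {x} {y} = mk⇔
  (λ t → subst₂ _<_ (sym (Fin.opposite-prop (π ⟨$⟩ʳ y))) (sym (Fin.opposite-prop (π ⟨$⟩ʳ x)))
     (ℕ.∸-monoʳ-< (s≤s (ℕ.<ᵇ⇒< _ _ t)) (Fin.toℕ<n (π ⟨$⟩ʳ y))))
  (λ y<x → ℕ.<⇒<ᵇ (ℕ.s≤s⁻¹ (ℕ.∸-cancelʳ-< {suc (toℕ (π ⟨$⟩ʳ y))} {o = n}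
     (subst₂ _<_ (Fin.opposite-prop (π ⟨$⟩ʳ y)) (Fin.opposite-prop (π ⟨$⟩ʳ x)) y<x))))

module _ (M : Matroid n) (π : Permutation′ n) where
  open Greedy M

  OPT-greedy : ∀ {x} → x ∈ OPT M π ⇔ Sel (betterFirst π) (λ _ → ⊤) x
  OPT-greedy = mk⇔
    (λ x∈ → tt , Unspanned-antitone (λ { (_ , lt) → ∈-allFin _ , lt }) (proj₂ (to (scan (λ _ _ → refl) _ (AllPairs.tabulate⁺-< id)) x∈)))
    (λ { (_ , free) → from (scan (λ _ _ → refl) _ (AllPairs.tabulate⁺-< id))
                        (∈-allFin _ , Unspanned-antitone (λ { (_ , lt) → tt , lt }) free) })
    where
    -- The invariant of the fold over any increasing list of ranks: it computes the greedy selection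
    -- among the elements of these ranks. It is stated for every `step` obeying the defining
    -- equation, so that it applies to the local `step` of `OPT`.
    scan : {step : Fin n → Subset n → Subset n} →
           (∀ r S → step r S ≡ (if indep M (⁅ π ⟨$⟩ˡ r ⁆ ∪ S) then ⁅ π ⟨$⟩ˡ r ⁆ ∪ S else S)) →
           ∀ rs → AllPairs Fin._<_ rs →
           ∀ {x} → x ∈ foldr step ⊥ rs ⇔ Sel (betterFirst π) (λ y → π ⟨$⟩ʳ y List.∈ rs) x
    scan step≡ [] _ = mk⇔ (λ x∈⊥ → contradiction x∈⊥ ∉⊥) (λ { (() , _) })
    scan {step} step≡ (r ∷ rs) (r< ∷ sorted) {x} = subst (λ S → x ∈ S ⇔ _) (sym (step≡ r S)) result
      where
      S = foldr step ⊥ rs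
      u = π ⟨$⟩ˡ r
      IH : ∀ {y} → y ∈ S ⇔ Sel (betterFirst π) (λ y → π ⟨$⟩ʳ y List.∈ rs) y
      IH = scan step≡ rs sorted
      -- The new rank `r` is the worst of the list, so it never lies among the elements better than
      -- a listed one; admitting it leaves the earlier freeness conditions unchanged.
      drop-worst : ∀ {y z} → π ⟨$⟩ʳ y List.∈ r ∷ rs → betterFirst π y Fin.< betterFirst π z →
                   π ⟨$⟩ʳ z ≡ r ⊎ π ⟨$⟩ʳ z List.∈ rs → π ⟨$⟩ʳ y List.∈ rs
      drop-worst (there y∈rs) _ _ = y∈rs
      drop-worst {y} {z} (here y≡r) y<z z∈ = contradiction (subst (_ Fin.<_) y≡r (ℕ.<ᵇ⇒< _ _ (from (≻⇔< π {z} {y}) y<z)))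
        ([ (λ z≡r → ℕ.<-irrefl (cong toℕ z≡r)) , (λ z∈rs → ℕ.<-asym (All.lookup r< z∈rs)) ]′ z∈)
      u∉S : u ∉ S
      u∉S u∈S = ℕ.<-irrefl refl (All.lookup r< (subst (List._∈ rs) (inverseʳ π) (proj₁ (to IH u∈S))))
      old : ∀ {y} → y ∈ S → Sel (betterFirst π) (λ y → π ⟨$⟩ʳ y List.∈ r ∷ rs) y
      old y∈S with to IH y∈S
      ... | y∈rs , free = there y∈rs , Unspanned-antitone (λ { (z∈ , lt) → drop-worst z∈ lt (inj₂ y∈rs) , lt }) free
      dropped : ∀ {y} → Sel (betterFirst π) (λ y → π ⟨$⟩ʳ y List.∈ r ∷ rs) y → π ⟨$⟩ʳ y List.∈ rs → y ∈ S
      dropped (_ , free) y∈rs = from IH (y∈rs , Unspanned-antitone (λ { (z∈ , lt) → there z∈ , lt }) free)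
      fresh : ∀ {y} → π ⟨$⟩ʳ y ≡ r → y ≡ u
      fresh y≡r = trans (sym (inverseˡ π)) (cong (π ⟨$⟩ˡ_) y≡r)
      result : x ∈ (if indep M (⁅ u ⁆ ∪ S) then ⁅ u ⁆ ∪ S else S) ⇔ Sel (betterFirst π) (λ y → π ⟨$⟩ʳ y List.∈ r ∷ rs) x
      result with indep M (⁅ u ⁆ ∪ S) in eq
      ... | true = mk⇔ split join
        where
        split : x ∈ ⁅ u ⁆ ∪ S → _
        split x∈ with ∈-insert⁻ S x∈
        ... | inj₂ x∈S = old x∈S
        -- By `Sel-complete` the set `S` is maximal among the better elements, so the single oracle
        -- answer for `⁅ u ⁆ ∪ S` decides freeness from all of them.
        ... | inj₁ refl = here (inverseʳ π) , Unspanned-antitone (λ { (z∈ , lt) → drop-worst z∈ lt (inj₁ (inverseʳ π)) })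
               (maximal-free S (proj₁ ∘ to IH) (λ y∈rs y∉S indep-yS → y∉S (Sel-complete IH y∈rs indep-yS)) u∉S
                 (subst T (sym eq) tt))
        join : _ → x ∈ ⁅ u ⁆ ∪ S
        join (here x≡r , _) = subst (_∈ ⁅ u ⁆ ∪ S) (sym (fresh x≡r)) (x∈⁅x⁆∪S S)
        join sel@(there x∈rs , _) = q⊆p∪q ⁅ u ⁆ S (dropped sel x∈rs)
      ... | false = mk⇔ old join
        where
        join : _ → x ∈ S
        join sel@(there x∈rs , _) = dropped sel x∈rs
        -- A selected element of rank `r` is `u`, and its freeness applied to the independent set
        -- `S` contradicts the oracle's answer.
        join (here x≡r , free) = ⊥-elim (subst T eq (subst (λ y → Indep (⁅ y ⁆ ∪ S)) (fresh x≡r) (free S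
          (λ y∈S → there (proj₁ (to IH y∈S)) , to (≻⇔< π) (ℕ.<⇒<ᵇ (subst (Fin._< _) (sym x≡r) (All.lookup r< (proj₁ (to IH y∈S))))))
          (Sel-indep (betterFirst-injective π) S (to IH)))))

-- Boolean tests on the revealed view, and the algorithm

T-not : ∀ {b} → T (not b) ⇔ (¬ T b)
T-not {true} = mk⇔ (λ ()) (λ ¬tt → ¬tt tt)
T-not {false} = mk⇔ (λ _ ()) (λ _ → tt)

T-ext : ∀ {a b} → (T a → T b) → (T b → T a) → a ≡ b
T-ext {true} {true} _ _ = refl
T-ext {true} {false} f _ = ⊥-elim (f tt)
T-ext {false} {true} _ g = ⊥-elim (g tt)
T-ext {false} {false} _ _ = refl

T-anyB : {f : Fin m → Bool} → T (anyB f) ⇔ (∃[ i ] T (f i))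
T-anyB {zero} = mk⇔ (λ ()) (λ ())
T-anyB {suc m} {f} = mk⇔ fwd bwd
  where
  fwd : T (f zero ∨ anyB (f ∘ suc)) → ∃[ i ] T (f i)
  fwd t with to (T-∨ {f zero}) t
  ... | inj₁ t₀ = zero , t₀
  ... | inj₂ t₊ with to T-anyB t₊
  ...   | i , tᵢ = suc i , tᵢ
  bwd : ∃[ i ] T (f i) → T (f zero ∨ anyB (f ∘ suc))
  bwd (zero , t) = from T-∨ (inj₁ t)
  bwd (suc i , t) = from (T-∨ {f zero}) (inj₂ (from T-anyB (i , t)))

∈-image : {f : Fin m → Fin n} {S : Subset m} {x : Fin n} → x ∈ image f S ⇔ (∃[ k ] (k ∈ S × f k ≡ x))
∈-image {f = f} {S} {x} = mk⇔ fwd bwd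
  where
  fwd : x ∈ image f S → ∃[ k ] (k ∈ S × f k ≡ x)
  fwd x∈ with to T-anyB (to ∈-tabulate x∈)
  ... | k , t with to (T-∧ {lookup S k}) t
  ...   | k∈S , fk≡x = k , from ∈⇔T k∈S , toWitness fk≡x
  bwd : ∃[ k ] (k ∈ S × f k ≡ x) → x ∈ image f S
  bwd (k , k∈S , fk≡x) = from ∈-tabulate (from T-anyB (k , from T-∧ (to ∈⇔T k∈S , fromWitness fk≡x)))

-- The failure of `Unspanned` written as an existential, which a finite search over sets of revealed
-- positions decides with the oracle alone.
spanning? : (ind : Subset m → Bool) (A : Fin m → Bool) (k : Fin m) →
            Dec (∃[ S ] ((∀ l → l ∈ S → T (A l)) × (T (ind S) × ¬ T (ind (⁅ k ⁆ ∪ S)))))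
spanning? ind A k = anySubset? (λ S → Fin.all? (λ l → (l ∈? S) →-dec T? (A l))
                                        ×-dec (T? (ind S) ×-dec ¬? (T? (ind (⁅ k ⁆ ∪ S)))))

-- Abstract because unfolding the search over all subsets makes unification blow up.
abstract
  unspannedB : (Subset m → Bool) → (Fin m → Bool) → Fin m → Bool
  unspannedB ind A k = not ⌊ spanning? ind A k ⌋

  T-unspannedB : {ind : Subset m → Bool} {A : Fin m → Bool} {k : Fin m} →
                 T (unspannedB ind A k) ⇔ Unspanned ind (T ∘ A) k
  T-unspannedB {ind = ind} {A} {k} = mk⇔
    (λ t S S⊆A indep-S → decidable-stable (T? (ind _))
       (λ dependent → to T-not t (fromWitness (S , (λ _ l∈S → S⊆A l∈S) , indep-S , dependent))))
    (λ free → from T-not (λ t → refute free (toWitness {a? = spanning? ind A k} t)))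
    where
    refute : Unspanned ind (T ∘ A) k → ¬ (∃[ S ] ((∀ l → l ∈ S → T (A l)) × (T (ind S) × ¬ T (ind (⁅ k ⁆ ∪ S)))))
    refute free (S , S⊆A , indep-S , dependent) = dependent (free S (S⊆A _) indep-S)

-- The algorithm tests sets of positions, the analysis sets of elements. A set of revealed elements
-- is the image of its preimage under `τ`, and injectivity keeps `P` meaningful on elements, so both
-- tests range over the same independent sets.
Unspanned-image : (ind : Subset n → Bool) {τ : Fin m → Fin n} → Injective _≡_ _≡_ τ → {P : Fin m → Set} {k : Fin m} →
                  Unspanned (ind ∘ image τ) P k ⇔ Unspanned ind (λ y → ∃[ l ] (τ l ≡ y × P l)) (τ k)
Unspanned-image {n} {m} ind {τ} τ-injective {P} {k} = mk⇔ fwd bwd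
  where
  image-insert : ∀ S → image τ (⁅ k ⁆ ∪ S) ≡ ⁅ τ k ⁆ ∪ image τ S
  image-insert S = ⊆-antisym
    (λ x∈ → let l , l∈ , τl≡x = to (∈-image {f = τ} {⁅ k ⁆ ∪ S}) x∈ in
      [ (λ l≡k → subst (_∈ ⁅ τ k ⁆ ∪ image τ S) (trans (cong τ (sym l≡k)) τl≡x) (x∈⁅x⁆∪S (image τ S)))
      , (λ l∈S → q⊆p∪q ⁅ τ k ⁆ _ (from ∈-image (l , l∈S , τl≡x))) ]′ (∈-insert⁻ S l∈))
    (insert-⊆ (from ∈-image (k , x∈⁅x⁆∪S S , refl))
      (λ x∈ → from ∈-image (map₂ (λ (l∈ , eq) → q⊆p∪q ⁅ k ⁆ S l∈ , eq) (to ∈-image x∈))))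
  fwd : Unspanned (ind ∘ image τ) P k → Unspanned ind (λ y → ∃[ l ] (τ l ≡ y × P l)) (τ k)
  fwd free U U⊆ indep-U = subst (T ∘ ind) (trans (image-insert S) (cong (⁅ τ k ⁆ ∪_) S-image))
                            (free S S⊆P (subst (T ∘ ind) (sym S-image) indep-U))
    where
    S : Subset m
    S = tabulate (λ l → lookup U (τ l))
    ∈S : ∀ {l} → l ∈ S ⇔ τ l ∈ U
    ∈S = mk⇔ (λ l∈ → from ∈⇔T (to ∈-tabulate l∈)) (λ τl∈ → from ∈-tabulate (to ∈⇔T τl∈))
    S⊆P : ∀ {l} → l ∈ S → P l
    S⊆P l∈S with U⊆ (to ∈S l∈S)
    ... | l′ , τl′≡τl , Pl′ = subst P (τ-injective τl′≡τl) Pl′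
    S-image : image τ S ≡ U
    S-image = ⊆-antisym
      (λ x∈ → let l , l∈ , τl≡x = to ∈-image x∈ in subst (_∈ U) τl≡x (to ∈S l∈))
      (λ x∈U → let l , τl≡x , _ = U⊆ x∈U in from ∈-image (l , from ∈S (subst (_∈ U) (sym τl≡x) x∈U) , τl≡x))
  bwd : Unspanned ind (λ y → ∃[ l ] (τ l ≡ y × P l)) (τ k) → Unspanned (ind ∘ image τ) P k
  bwd free S S⊆P indep-S = subst (T ∘ ind) (sym (image-insert S))
    (free (image τ S) (λ x∈ → let l , l∈S , τl≡x = to ∈-image x∈ in l , τl≡x , S⊆P l∈S) indep-S)

module _ (s : ℕ) (cmp : Fin m → Fin m → Bool) (ind : Subset m → Bool) where

  -- The bound on `l` cuts the present view back to what was revealed when `k` arrived, so the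
  -- status of every past arrival can be recomputed from a later view.
  improving : Fin m → Bool
  improving k = not (toℕ k <ᵇ s) ∧ unspannedB ind (λ l → (toℕ l <ᵇ suc (toℕ k)) ∧ cmp l k) k

  -- The test is against the earlier improving elements and not the accepted ones. Both have the
  -- same closure, and this form needs no recursion through earlier decisions.
  accepting : Fin m → Bool
  accepting k = improving k ∧ unspannedB ind (λ l → improving l ∧ (toℕ l <ᵇ toℕ k)) k

algorithm : Algorithm
algorithm = record
  { seeds  = λ _ → 0
  ; decide = λ n _ i cmp ind → accepting ⌊ n /2⌋ cmp ind (Fin.fromℕ (toℕ i))
  }

injective⇒surjective : {f : Fin n → Fin n} → Injective _≡_ _≡_ f → ∀ y → ∃[ x ] (f x ≡ y)
injective⇒surjective {suc n} {f} f-injective y with Fin.any? (λ x → f x Fin.≟ y)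
... | yes found = found
... | no missed = contradiction (Fin.injective⇒≤ (λ {a} {b} eq → f-injective
        (Fin.punchOut-injective (avoid a) (avoid b) eq))) ℕ.1+n≰n
  where
  avoid : ∀ x → y ≢ f x
  avoid x y≡fx = missed (x , sym y≡fx)

injective⇒permutation : {f : Fin n → Fin n} → Injective _≡_ _≡_ f → ∃[ ω ] (∀ i → ω ⟨$⟩ʳ i ≡ f i)
injective⇒permutation {f = f} f-injective = permutation f (proj₁ ∘ preimage)
  (λ y → proj₂ (preimage y)) (λ x → f-injective (proj₂ (preimage (f x)))) , λ _ → refl
  where
  preimage = injective⇒surjective f-injective

-- Counting with indicators

ι : Bool → ℕ
ι true = 1
ι false = 0

ι-∧ : ∀ a b → ι (a ∧ b) ≡ ι a * ι b
ι-∧ true b = sym (ℕ.+-identityʳ (ι b))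
ι-∧ false _ = refl

sum-mono : {f g : Fin n → ℕ} → (∀ i → f i ≤ g i) → sum f ≤ sum g
sum-mono {zero} _ = z≤n
sum-mono {suc n} f≤g = ℕ.+-mono-≤ (f≤g zero) (sum-mono (f≤g ∘ suc))

∣S∣≡sum : (S : Subset n) → ∣ S ∣ ≡ sum (ι ∘ lookup S)
∣S∣≡sum [] = refl
∣S∣≡sum (true ∷ S) = cong suc (∣S∣≡sum S)
∣S∣≡sum (false ∷ S) = ∣S∣≡sum S

∣tabulate∣≡sum : (f : Fin n → Bool) → ∣ tabulate f ∣ ≡ sum (ι ∘ f)
∣tabulate∣≡sum f = trans (∣S∣≡sum (tabulate f)) (sum-cong-≗ (cong ι ∘ Vec.lookup∘tabulate f))

-- This is ∣ A ∣ + ∣ B ∣ = ∣ A ∩ B ∣ + ∣ A ∪ B ∣ with A ∩ B inside C ∩ A and A ∪ B inside D, checked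
-- on indicators point by point.
∣A∣+∣B∣≤∣C∩A∣+∣D∣ : (A B C D : Subset n) → A ⊆ D → B ⊆ C → B ⊆ D → ∣ A ∣ + ∣ B ∣ ≤ ∣ C ∩ A ∣ + ∣ D ∣
∣A∣+∣B∣≤∣C∩A∣+∣D∣ A B C D A⊆D B⊆C B⊆D = begin
  ∣ A ∣ + ∣ B ∣                                                    ≡⟨ cong₂ _+_ (∣S∣≡sum A) (∣S∣≡sum B) ⟩
  sum (ι ∘ lookup A) + sum (ι ∘ lookup B)                         ≡⟨ ∑-distrib-+ (ι ∘ lookup A) (ι ∘ lookup B) ⟨
  sum (λ x → ι (lookup A x) + ι (lookup B x))                     ≤⟨ sum-mono (λ x → pointwise _ _ _ _ (via A D x A⊆D) (via B C x B⊆C) (via B D x B⊆D)) ⟩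
  sum (λ x → ι (lookup C x ∧ lookup A x) + ι (lookup D x))        ≡⟨ ∑-distrib-+ (λ x → ι (lookup C x ∧ lookup A x)) (ι ∘ lookup D) ⟩
  sum (λ x → ι (lookup C x ∧ lookup A x)) + sum (ι ∘ lookup D)    ≡⟨ cong₂ _+_ (trans (∣S∣≡sum (C ∩ A)) (sum-cong-≗ (λ x → cong ι (Vec.lookup-zipWith _∧_ x C A)))) (∣S∣≡sum D) ⟨
  ∣ C ∩ A ∣ + ∣ D ∣                                                ∎
  where
  open ℕ.≤-Reasoning
  via : (U V : Subset n) (x : Fin n) → U ⊆ V → T (lookup U x) → T (lookup V x)
  via U V x U⊆V = to ∈⇔T ∘ U⊆V ∘ from ∈⇔T
  pointwise : ∀ a b c d → (T a → T d) → (T b → T c) → (T b → T d) → ι a + ι b ≤ ι (c ∧ a) + ι d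
  pointwise true  true  true  true  _ _ _ = ℕ.≤-refl
  pointwise true  true  false _     _ q _ = ⊥-elim (q tt)
  pointwise true  _     _     false p _ _ = ⊥-elim (p tt)
  pointwise _     true  _     false _ _ r = ⊥-elim (r tt)
  pointwise true  false c     true  _ _ _ = ℕ.m≤n+m 1 (ι (c ∧ true))
  pointwise false true  c     true  _ _ _ = ℕ.m≤n+m 1 (ι (c ∧ false))
  pointwise false false _     _     _ _ _ = z≤n

-- One arrival order

inPrefix : (Fin n → Fin n) → ℕ → Fin n → Bool
inPrefix σ i y = anyB (λ l → (toℕ l <ᵇ suc i) ∧ (σ l =ᶠ y))

-- The prefix length `i` is separate from the position of `x`, and `σ` matters only through the set
-- of its first `i + 1` values. This lets `x` move within the prefix while the condition stays
-- fixed.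
improvesPrefix : Matroid n → Permutation′ n → (Fin n → Fin n) → ℕ → Fin n → Bool
improvesPrefix M π σ i x = unspannedB (indep M) (λ y → inPrefix σ i y ∧ (y ≻[ π ] x)) x

afterSample : Fin n → Bool
afterSample {n} i = not (toℕ i <ᵇ ⌊ n /2⌋)

module Arrival (M : Matroid n) (π : Permutation′ n) {σ : Fin n → Fin n} (σ-injective : Injective _≡_ _≡_ σ) where
  open Greedy M

  arrival : Fin n → Fin n
  arrival x = proj₁ (injective⇒surjective σ-injective x)

  σ-arrival : ∀ x → σ (arrival x) ≡ x
  σ-arrival x = proj₂ (injective⇒surjective σ-injective x)

  arrival-σ : ∀ i → arrival (σ i) ≡ i
  arrival-σ i = σ-injective (σ-arrival (σ i))

  arrival-injective : Injective _≡_ _≡_ arrival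
  arrival-injective {x} {y} eq = trans (sym (σ-arrival x)) (trans (cong σ eq) (σ-arrival y))

  Better : Fin n → Fin n → Set
  Better x y = arrival y Fin.≤ arrival x × T (y ≻[ π ] x)

  -- The second component is membership of `x` in the greedy base of everything revealed up to its
  -- arrival.
  Improving : Fin n → Set
  Improving x = (⌊ n /2⌋ ≤ toℕ (arrival x)) × Free (Better x) x

  module _ (i : Fin n) where
    private
      τ : Fin (suc (toℕ i)) → Fin n
      τ = prefix σ i
      cmp : Fin (suc (toℕ i)) → Fin (suc (toℕ i)) → Bool
      cmp k l = τ k ≻[ π ] τ l
      ind : Subset (suc (toℕ i)) → Bool
      ind S = indep M (image τ S)
      last : Fin (suc (toℕ i))
      last = Fin.fromℕ (toℕ i)

    τ-injective : Injective _≡_ _≡_ τ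
    τ-injective eq = Fin.inject≤-injective _ _ _ _ (σ-injective eq)

    arrival-τ : ∀ l → toℕ (arrival (τ l)) ≡ toℕ l
    arrival-τ l = trans (cong toℕ (arrival-σ _)) (Fin.toℕ-inject≤ l _)

    τ-surjective : ∀ {y} → toℕ (arrival y) ≤ toℕ i → ∃[ l ] (τ l ≡ y)
    τ-surjective {y} y≤i = Fin.fromℕ< (s≤s y≤i) , trans (cong σ (Fin.toℕ-injective
      (trans (Fin.toℕ-inject≤ _ _) (Fin.toℕ-fromℕ< (s≤s y≤i))))) (σ-arrival y)

    τ-last : τ last ≡ σ i
    τ-last = cong σ (Fin.toℕ-injective (trans (Fin.toℕ-inject≤ last _) (Fin.toℕ-fromℕ (toℕ i))))

    improving⇔ : ∀ k → T (improving ⌊ n /2⌋ cmp ind k) ⇔ Improving (τ k)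
    improving⇔ k = mk⇔
      (λ t → let post , free = to (T-∧ {not (toℕ k <ᵇ ⌊ n /2⌋)}) t in
        subst (⌊ n /2⌋ ≤_) (sym (arrival-τ k)) (ℕ.≮⇒≥ (to T-not post ∘ ℕ.<⇒<ᵇ)) ,
        Unspanned-antitone (λ {y} → earlier {y}) (to (Unspanned-image (indep M) τ-injective) (to T-unspannedB free)))
      (λ (post , free) → from T-∧
        ( from T-not (ℕ.≤⇒≯ (subst (⌊ n /2⌋ ≤_) (arrival-τ k) post) ∘ ℕ.<ᵇ⇒< _ _)
        , from T-unspannedB (from (Unspanned-image (indep M) τ-injective) (Unspanned-antitone (λ {y} → revealed {y}) free))))
      where
      earlier : ∀ {y} → Better (τ k) y → ∃[ l ] (τ l ≡ y × T ((toℕ l <ᵇ suc (toℕ k)) ∧ cmp l k))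
      earlier (y≤ , y≻) with τ-surjective (ℕ.≤-trans y≤ (ℕ.≤-trans (ℕ.≤-reflexive (arrival-τ k)) (ℕ.s≤s⁻¹ (Fin.toℕ<n k))))
      ... | l , refl = l , refl , from T-∧
              (ℕ.<⇒<ᵇ {toℕ l} (s≤s (subst₂ _≤_ (arrival-τ l) (arrival-τ k) y≤)) , y≻)
      revealed : ∀ {y} → ∃[ l ] (τ l ≡ y × T ((toℕ l <ᵇ suc (toℕ k)) ∧ cmp l k)) → Better (τ k) y
      revealed (l , refl , t) with to (T-∧ {toℕ l <ᵇ suc (toℕ k)}) t
      ... | l≤k , l≻k = subst₂ _≤_ (sym (arrival-τ l)) (sym (arrival-τ k)) (ℕ.s≤s⁻¹ (ℕ.<ᵇ⇒< (toℕ l) _ l≤k)) , l≻k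

    accepting⇔ : T (accepting ⌊ n /2⌋ cmp ind last) ⇔ Sel arrival Improving (σ i)
    accepting⇔ = subst (λ x → T (accepting ⌊ n /2⌋ cmp ind last) ⇔ Sel arrival Improving x) τ-last (mk⇔
      (λ t → let imp , free = to (T-∧ {improving ⌊ n /2⌋ cmp ind last}) t in
        to (improving⇔ last) imp ,
        Unspanned-antitone (λ {y} → earlier {y}) (to (Unspanned-image (indep M) τ-injective) (to T-unspannedB free)))
      (λ (imp , free) → from T-∧
        ( from (improving⇔ last) imp
        , from T-unspannedB (from (Unspanned-image (indep M) τ-injective) (Unspanned-antitone (λ {y} → revealed {y}) free)))))
      where
      earlier : ∀ {y} → Improving y × arrival y Fin.< arrival (τ last) →
                ∃[ l ] (τ l ≡ y × T (improving ⌊ n /2⌋ cmp ind l ∧ (toℕ l <ᵇ toℕ last)))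
      earlier (imp , y<) with τ-surjective (ℕ.<⇒≤ (ℕ.<-≤-trans y< (ℕ.≤-reflexive (trans (arrival-τ last) (Fin.toℕ-fromℕ _)))))
      ... | l , refl = l , refl , from T-∧
              (from (improving⇔ l) imp , ℕ.<⇒<ᵇ (subst₂ _<_ (arrival-τ l) (arrival-τ last) y<))
      revealed : ∀ {y} → ∃[ l ] (τ l ≡ y × T (improving ⌊ n /2⌋ cmp ind l ∧ (toℕ l <ᵇ toℕ last))) →
                 Improving y × arrival y Fin.< arrival (τ last)
      revealed (l , refl , t) with to (T-∧ {improving ⌊ n /2⌋ cmp ind l}) t
      ... | imp , l< = to (improving⇔ l) imp , subst₂ _<_ (sym (arrival-τ l)) (sym (arrival-τ last)) (ℕ.<ᵇ⇒< _ _ l<)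

  accepted : Subset n
  accepted = ALG algorithm M π zero σ

  accepted-greedy : ∀ {x} → x ∈ accepted ⇔ Sel arrival Improving x
  accepted-greedy {x} = mk⇔
    (λ x∈ → let i , i∈ , σi≡x = to ∈-image x∈ in
      subst (Sel arrival Improving) σi≡x (to (accepting⇔ i) (to ∈-tabulate i∈)))
    (λ sel → from ∈-image (arrival x , from ∈-tabulate
      (from (accepting⇔ (arrival x)) (subst (Sel arrival Improving) (sym (σ-arrival x)) sel)) , σ-arrival x))

  accepted-indep : Indep accepted
  accepted-indep = Sel-indep arrival-injective accepted (to accepted-greedy)

  T-inPrefix : ∀ {i y} → T (inPrefix σ i y) ⇔ toℕ (arrival y) ≤ i
  T-inPrefix {i} {y} = mk⇔ fwd bwd
    where
    fwd : T (inPrefix σ i y) → toℕ (arrival y) ≤ i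
    fwd t with to T-anyB t
    ... | l , t′ with to (T-∧ {toℕ l <ᵇ suc i}) t′
    ...   | l≤i , σl≡y = subst (λ k → toℕ k ≤ i) (trans (sym (arrival-σ l)) (cong arrival (toWitness σl≡y)))
                           (ℕ.s≤s⁻¹ (ℕ.<ᵇ⇒< (toℕ l) (suc i) l≤i))
    bwd : toℕ (arrival y) ≤ i → T (inPrefix σ i y)
    bwd y≤i = from T-anyB (arrival y , from T-∧ (ℕ.<⇒<ᵇ (s≤s y≤i) , fromWitness (σ-arrival y)))

  T-improvesPrefix : ∀ {i x} → T (improvesPrefix M π σ i x) ⇔ Free (λ y → toℕ (arrival y) ≤ i × T (y ≻[ π ] x)) x
  T-improvesPrefix {i} {x} = mk⇔
    (λ t → Unspanned-antitone (λ (y≤i , y≻x) → from T-∧ (from T-inPrefix y≤i , y≻x)) (to T-unspannedB t))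
    (λ free → from T-unspannedB (Unspanned-antitone (λ {y} t → let y≤i , y≻x = to (T-∧ {inPrefix σ i y}) t in to T-inPrefix y≤i , y≻x) free))

  late : Fin n → Bool
  late x = afterSample (arrival x)

  T-late : ∀ {x} → T (late x) ⇔ ⌊ n /2⌋ ≤ toℕ (arrival x)
  T-late = mk⇔ (λ t → ℕ.≮⇒≥ (to T-not t ∘ ℕ.<⇒<ᵇ)) (λ h → from T-not (ℕ.≤⇒≯ h ∘ ℕ.<ᵇ⇒< _ _))

  improver : Fin n → Bool
  improver x = late x ∧ improvesPrefix M π σ (toℕ (arrival x)) x

  T-improver : ∀ {x} → T (improver x) ⇔ Improving x
  T-improver {x} = mk⇔
    (λ t → let post , free = to (T-∧ {late x}) t in to T-late post , to T-improvesPrefix free)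
    (λ (post , free) → from T-∧ (from T-late post , from T-improvesPrefix free))

  lateOpt : Fin n → Bool
  lateOpt x = late x ∧ lookup (OPT M π) x

  lateOpt⊆OPT : tabulate lateOpt ⊆ OPT M π
  lateOpt⊆OPT {x} x∈ = from ∈⇔T (proj₂ (to (T-∧ {late x}) (to ∈-tabulate x∈)))

  -- An element of `OPT` is free from all better elements, hence from those already revealed.
  lateOpt⊆improver : ∀ {x} → x ∈ tabulate lateOpt → Improving x
  lateOpt⊆improver {x} x∈ = to T-late (proj₁ (to (T-∧ {late x}) (to ∈-tabulate x∈))) ,
    Unspanned-antitone (λ (_ , y≻x) → tt , to (≻⇔< π) y≻x) (proj₂ (to (OPT-greedy M π) (lateOpt⊆OPT x∈)))

  -- The late part of OPT is independent and improving, so the accepted set is at least as large;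
  -- hence a late OPT element can only be lost to an improving element outside OPT.
  hits-bound : 2 * ∣ tabulate lateOpt ∣ ≤ ∣ OPT M π ∩ accepted ∣ + ∣ tabulate improver ∣
  hits-bound = begin
    2 * ∣ O ∣                             ≡⟨ cong (∣ O ∣ +_) (ℕ.+-identityʳ ∣ O ∣) ⟩
    ∣ O ∣ + ∣ O ∣                         ≤⟨ ℕ.+-monoˡ-≤ ∣ O ∣ (Sel-maximum accepted-greedy arrival-injective O lateOpt⊆improver
                                             (indep-⊆ M lateOpt⊆OPT (Sel-indep (betterFirst-injective π) (OPT M π) (to (OPT-greedy M π))))) ⟩
    ∣ accepted ∣ + ∣ O ∣                  ≤⟨ ∣A∣+∣B∣≤∣C∩A∣+∣D∣ accepted O (OPT M π) (tabulate improver)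
                                             (from ∈-tabulate ∘ from T-improver ∘ proj₁ ∘ to accepted-greedy)
                                             lateOpt⊆OPT
                                             (from ∈-tabulate ∘ from T-improver ∘ lateOpt⊆improver) ⟩
    ∣ OPT M π ∩ accepted ∣ + ∣ tabulate improver ∣ ∎
    where
    open ℕ.≤-Reasoning
    O = tabulate lateOpt

  sum-by-arrival : (f : Fin n → ℕ) → sum f ≡ sum (f ∘ σ)
  sum-by-arrival f with injective⇒permutation σ-injective
  ... | ω , ω≡σ = trans (sum-permute f ω) (sum-cong-≗ (cong f ∘ ω≡σ))

  -- Indexing by arrival position instead of by element lets each position be averaged separately
  -- over the orders.
  hits-bound-by-arrival :
    2 * sum (λ i → ι (afterSample i) * ι (lookup (OPT M π) (σ i)))
      ≤ ∣ OPT M π ∩ accepted ∣ + sum (λ i → ι (afterSample i) * ι (improvesPrefix M π σ (toℕ i) (σ i)))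
  hits-bound-by-arrival = subst₂ (λ a b → 2 * a ≤ ∣ OPT M π ∩ accepted ∣ + b)
    (trans (∣tabulate∣≡sum lateOpt) (trans (sum-by-arrival (ι ∘ lateOpt)) (sum-cong-≗ λ i →
       trans (ι-∧ (late (σ i)) _) (cong (λ k → ι (afterSample k) * ι (lookup (OPT M π) (σ i))) (arrival-σ i)))))
    (trans (∣tabulate∣≡sum improver) (trans (sum-by-arrival (ι ∘ improver)) (sum-cong-≗ λ i →
       trans (ι-∧ (late (σ i)) _) (cong (λ k → ι (afterSample k) * ι (improvesPrefix M π σ (toℕ k) (σ i))) (arrival-σ i)))))
    hits-bound

  OPT-by-arrival : sum (λ i → ι (lookup (OPT M π) (σ i))) ≡ ∣ OPT M π ∣
  OPT-by-arrival = sym (trans (∣S∣≡sum (OPT M π)) (sum-by-arrival (ι ∘ lookup (OPT M π))))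

  -- The elements counted are greedily selected from the prefix in order of quality. They are
  -- therefore independent, and no independent set is larger than `OPT`.
  prefix-improvers≤∣OPT∣ : ∀ i → sum (λ p → ι (toℕ p <ᵇ suc i) * ι (improvesPrefix M π σ i (σ p))) ≤ ∣ OPT M π ∣
  prefix-improvers≤∣OPT∣ i = begin
    sum (λ p → ι (toℕ p <ᵇ suc i) * ι (improvesPrefix M π σ i (σ p)))
      ≡⟨ sum-cong-≗ (λ p → trans (sym (ι-∧ (toℕ p <ᵇ suc i) _)) (cong (λ k → ι ((toℕ k <ᵇ suc i) ∧ improvesPrefix M π σ i (σ p))) (sym (arrival-σ p)))) ⟩
    sum (ι ∘ member ∘ σ)       ≡⟨ sum-by-arrival (ι ∘ member) ⟨
    sum (ι ∘ member)           ≡⟨ ∣tabulate∣≡sum member ⟨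
    ∣ tabulate member ∣        ≤⟨ Sel-maximum (OPT-greedy M π) (betterFirst-injective π) (tabulate member) (λ _ → tt)
                                    (Sel-indep (betterFirst-injective π) (tabulate member) selected) ⟩
    ∣ OPT M π ∣                ∎
    where
    open ℕ.≤-Reasoning
    member : Fin n → Bool
    member x = (toℕ (arrival x) <ᵇ suc i) ∧ improvesPrefix M π σ i x
    selected : ∀ {x} → x ∈ tabulate member → Sel (betterFirst π) (λ y → toℕ (arrival y) ≤ i) x
    selected {x} x∈ with to (T-∧ {toℕ (arrival x) <ᵇ suc i}) (to ∈-tabulate x∈)
    ... | x≤i , free = ℕ.s≤s⁻¹ (ℕ.<ᵇ⇒< _ _ x≤i) ,
            Unspanned-antitone (λ (y≤i , y<x) → y≤i , from (≻⇔< π) y<x) (to T-improvesPrefix free)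

feasible : Feasible algorithm
feasible n M π zero σ σ-injective = Arrival.accepted-indep M π (λ {i} {j} → σ-injective {i} {j})

-- Sums over arrival orders

∑ᴸ : List A → (A → ℕ) → ℕ
∑ᴸ xs f = sumL (List.map f xs)

∑ᴸ-cong : {f g : A → ℕ} (xs : List A) → (∀ x → x List.∈ xs → f x ≡ g x) → ∑ᴸ xs f ≡ ∑ᴸ xs g
∑ᴸ-cong [] _ = refl
∑ᴸ-cong (x ∷ xs) f≡g = cong₂ _+_ (f≡g x (here refl)) (∑ᴸ-cong xs λ y y∈ → f≡g y (there y∈))

∑ᴸ-mono : {f g : A → ℕ} (xs : List A) → (∀ x → x List.∈ xs → f x ≤ g x) → ∑ᴸ xs f ≤ ∑ᴸ xs g
∑ᴸ-mono [] _ = z≤n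
∑ᴸ-mono (x ∷ xs) f≤g = ℕ.+-mono-≤ (f≤g x (here refl)) (∑ᴸ-mono xs λ y y∈ → f≤g y (there y∈))

∑ᴸ-distrib-+ : (xs : List A) (f g : A → ℕ) → ∑ᴸ xs (λ x → f x + g x) ≡ ∑ᴸ xs f + ∑ᴸ xs g
∑ᴸ-distrib-+ [] f g = refl
∑ᴸ-distrib-+ (x ∷ xs) f g = trans (cong (f x + g x +_) (∑ᴸ-distrib-+ xs f g)) (+-interchange (f x) (g x) _ _)

∑ᴸ-distribˡ-* : (xs : List A) (c : ℕ) (f : A → ℕ) → ∑ᴸ xs (λ x → c * f x) ≡ c * ∑ᴸ xs f
∑ᴸ-distribˡ-* [] c f = sym (ℕ.*-zeroʳ c)
∑ᴸ-distribˡ-* (x ∷ xs) c f = trans (cong (c * f x +_) (∑ᴸ-distribˡ-* xs c f)) (sym (ℕ.*-distribˡ-+ c (f x) _))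

∑ᴸ-const : (xs : List A) (c : ℕ) → ∑ᴸ xs (λ _ → c) ≡ length xs * c
∑ᴸ-const [] c = refl
∑ᴸ-const (x ∷ xs) c = cong (c +_) (∑ᴸ-const xs c)

∑ᴸ-sum-comm : (xs : List A) (f : Fin n → A → ℕ) → ∑ᴸ xs (λ x → sum (λ i → f i x)) ≡ sum (λ i → ∑ᴸ xs (f i))
∑ᴸ-sum-comm {n = zero} xs f = trans (∑ᴸ-const xs 0) (ℕ.*-zeroʳ (length xs))
∑ᴸ-sum-comm {n = suc n} xs f = trans (∑ᴸ-distrib-+ xs (f zero) _) (cong (∑ᴸ xs (f zero) +_) (∑ᴸ-sum-comm xs (f ∘ suc)))

∑ᴸ-++ : (xs ys : List A) (f : A → ℕ) → ∑ᴸ (xs List.++ ys) f ≡ ∑ᴸ xs f + ∑ᴸ ys f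
∑ᴸ-++ [] ys f = refl
∑ᴸ-++ (x ∷ xs) ys f = trans (cong (f x +_) (∑ᴸ-++ xs ys f)) (sym (ℕ.+-assoc (f x) _ _))

∑ᴸ-map : (g : A → B) (xs : List A) (f : B → ℕ) → ∑ᴸ (List.map g xs) f ≡ ∑ᴸ xs (f ∘ g)
∑ᴸ-map g [] f = refl
∑ᴸ-map g (x ∷ xs) f = cong (f (g x) +_) (∑ᴸ-map g xs f)

∑ᴸ-concatMap : (g : A → List B) (xs : List A) (f : B → ℕ) → ∑ᴸ (concatMap g xs) f ≡ ∑ᴸ xs (λ x → ∑ᴸ (g x) f)
∑ᴸ-concatMap g [] f = refl
∑ᴸ-concatMap g (x ∷ xs) f = trans (∑ᴸ-++ (g x) _ f) (cong (∑ᴸ (g x) f +_) (∑ᴸ-concatMap g xs f))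

∑ᴸ-tabulate : (g : Fin n → A) (f : A → ℕ) → ∑ᴸ (List.tabulate g) f ≡ sum (f ∘ g)
∑ᴸ-tabulate {n = zero} g f = refl
∑ᴸ-tabulate {n = suc n} g f = cong (f (g zero) +_) (∑ᴸ-tabulate (g ∘ suc) f)

∑ᴸ-filter : (b : A → Bool) (xs : List A) (f : A → ℕ) → ∑ᴸ (filter (T? ∘ b) xs) f ≡ ∑ᴸ xs (λ x → ι (b x) * f x)
∑ᴸ-filter b [] f = refl
∑ᴸ-filter b (x ∷ xs) f with b x
... | true  = cong₂ _+_ (sym (ℕ.+-identityʳ (f x))) (∑ᴸ-filter b xs f)
... | false = ∑ᴸ-filter b xs f

∑ᴸ-allVecs : ∀ k (f : Vec (Fin n) (suc k) → ℕ) →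
             ∑ᴸ (allVecs n (suc k)) f ≡ sum (λ x → ∑ᴸ (allVecs n k) (λ v → f (x ∷ v)))
∑ᴸ-allVecs {n} k f =
  trans (∑ᴸ-concatMap (λ x → List.map (x ∷_) (allVecs n k)) (List.allFin n) f)
    (trans (∑ᴸ-tabulate {n = n} id (λ x → ∑ᴸ (List.map (x ∷_) (allVecs n k)) f)) (sum-cong-≗ λ x → ∑ᴸ-map (x ∷_) (allVecs n k) f))

-- Swapping neighbouring arrivals

swapAt : ∀ {k} → ℕ → Vec A k → Vec A k
swapAt _       []          = []
swapAt zero    (x ∷ [])    = x ∷ []
swapAt zero    (x ∷ y ∷ v) = y ∷ x ∷ v
swapAt (suc a) (x ∷ v)     = x ∷ swapAt a v

-- Over all vectors, repetitions included, neighbouring coordinates are two nested sums that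
-- commute. This is why only neighbours are swapped, and why injectivity is carried as a weight and
-- not as a restriction of the list.
∑ᴸ-allVecs-swap : ∀ a k (f : Vec (Fin n) k → ℕ) → ∑ᴸ (allVecs n k) f ≡ ∑ᴸ (allVecs n k) (f ∘ swapAt a)
∑ᴸ-allVecs-swap zero 0 f = refl
∑ᴸ-allVecs-swap zero 1 f = trans (∑ᴸ-allVecs 0 f) (sym (∑ᴸ-allVecs 0 (f ∘ swapAt zero)))
∑ᴸ-allVecs-swap {n} zero (suc (suc k)) f = begin
  ∑ᴸ (allVecs n (2 + k)) f                                               ≡⟨ twice f ⟩
  sum (λ x → sum (λ y → ∑ᴸ (allVecs n k) (λ v → f (x ∷ y ∷ v))))          ≡⟨ ∑-comm (λ x y → ∑ᴸ (allVecs n k) (λ v → f (x ∷ y ∷ v))) ⟩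
  sum (λ y → sum (λ x → ∑ᴸ (allVecs n k) (λ v → f (x ∷ y ∷ v))))          ≡⟨ twice (f ∘ swapAt zero) ⟨
  ∑ᴸ (allVecs n (2 + k)) (f ∘ swapAt zero)                               ∎
  where
  open ≡-Reasoning
  twice : ∀ f → ∑ᴸ (allVecs n (2 + k)) f ≡ sum (λ x → sum (λ y → ∑ᴸ (allVecs n k) (λ v → f (x ∷ y ∷ v))))
  twice f = trans (∑ᴸ-allVecs (suc k) f) (sum-cong-≗ λ x → ∑ᴸ-allVecs k (f ∘ (x ∷_)))
∑ᴸ-allVecs-swap (suc a) 0 f = refl
∑ᴸ-allVecs-swap (suc a) (suc k) f = trans (∑ᴸ-allVecs k f)
  (trans (sum-cong-≗ λ x → ∑ᴸ-allVecs-swap a k (f ∘ (x ∷_))) (sym (∑ᴸ-allVecs k (f ∘ swapAt (suc a)))))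

swapAt-involutive : ∀ {k} a (v : Vec A k) → swapAt a (swapAt a v) ≡ v
swapAt-involutive zero [] = refl
swapAt-involutive (suc a) [] = refl
swapAt-involutive zero (x ∷ []) = refl
swapAt-involutive zero (x ∷ y ∷ v) = refl
swapAt-involutive (suc a) (x ∷ v) = cong (x ∷_) (swapAt-involutive a v)

lookup-swapAt : ∀ {k} a (v : Vec A k) {p q : Fin k} → toℕ p ≡ a → toℕ q ≡ suc a → lookup (swapAt a v) p ≡ lookup v q
lookup-swapAt zero (x ∷ y ∷ v) {zero} {suc zero} _ _ = refl
lookup-swapAt (suc a) (x ∷ v) {suc p} {suc q} p≡ q≡ = lookup-swapAt a v (ℕ.suc-injective p≡) (ℕ.suc-injective q≡)

adjacent : ∀ {k} → ℕ → Fin k → Fin k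
adjacent {1}           zero    l             = l
adjacent {suc (suc k)} zero    zero          = suc zero
adjacent {suc (suc k)} zero    (suc zero)    = zero
adjacent {suc (suc k)} zero    (suc (suc l)) = suc (suc l)
adjacent               (suc a) zero          = zero
adjacent               (suc a) (suc l)       = suc (adjacent a l)

adjacent-lookup : ∀ {k} a (v : Vec A k) l → lookup (swapAt a v) l ≡ lookup v (adjacent a l)
adjacent-lookup zero (x ∷ []) zero = refl
adjacent-lookup zero (x ∷ y ∷ v) zero = refl
adjacent-lookup zero (x ∷ y ∷ v) (suc zero) = refl
adjacent-lookup zero (x ∷ y ∷ v) (suc (suc l)) = refl
adjacent-lookup (suc a) (x ∷ v) zero = refl
adjacent-lookup (suc a) (x ∷ v) (suc l) = adjacent-lookup a v l

adjacent-injective : ∀ {k} a → Injective _≡_ _≡_ (adjacent {k} a)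
adjacent-injective {1} zero eq = eq
adjacent-injective {suc (suc k)} zero {zero} {zero} eq = refl
adjacent-injective {suc (suc k)} zero {zero} {suc zero} ()
adjacent-injective {suc (suc k)} zero {zero} {suc (suc _)} ()
adjacent-injective {suc (suc k)} zero {suc zero} {zero} ()
adjacent-injective {suc (suc k)} zero {suc zero} {suc zero} eq = refl
adjacent-injective {suc (suc k)} zero {suc zero} {suc (suc _)} ()
adjacent-injective {suc (suc k)} zero {suc (suc _)} {zero} ()
adjacent-injective {suc (suc k)} zero {suc (suc _)} {suc zero} ()
adjacent-injective {suc (suc k)} zero {suc (suc l)} {suc (suc l′)} eq = eq
adjacent-injective (suc a) {zero} {zero} eq = refl
adjacent-injective (suc a) {suc l} {suc l′} eq = cong suc (adjacent-injective a (Fin.suc-injective eq))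

adjacent-≤ : ∀ {k} a {i} (l : Fin k) → a < i → toℕ l ≤ i → toℕ (adjacent a l) ≤ i
adjacent-≤ {1} zero l a<i l≤i = l≤i
adjacent-≤ {suc (suc k)} zero zero a<i l≤i = a<i
adjacent-≤ {suc (suc k)} zero (suc zero) a<i l≤i = z≤n
adjacent-≤ {suc (suc k)} zero (suc (suc l)) a<i l≤i = l≤i
adjacent-≤ (suc a) zero a<i l≤i = z≤n
adjacent-≤ (suc a) (suc l) (s≤s a<i) (s≤s l≤i) = s≤s (adjacent-≤ a l a<i l≤i)

T-allB : {f : Fin m → Bool} → T (allB f) ⇔ (∀ i → T (f i))
T-allB {zero} = mk⇔ (λ _ ()) (λ _ → tt)
T-allB {suc m} {f} = mk⇔ fwd (λ all → from T-∧ (all zero , from T-allB (all ∘ suc)))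
  where
  fwd : T (f zero ∧ allB (f ∘ suc)) → ∀ i → T (f i)
  fwd t zero = proj₁ (to (T-∧ {f zero}) t)
  fwd t (suc i) = to T-allB (proj₂ (to (T-∧ {f zero}) t)) i

T-injectiveB : (v : Vec (Fin n) n) → T (injectiveB v) ⇔ Injective _≡_ _≡_ (lookup v)
T-injectiveB v = mk⇔ fwd bwd
  where
  fwd : T (injectiveB v) → Injective _≡_ _≡_ (lookup v)
  fwd t {i} {j} eq with to (T-∨ {not (lookup v i =ᶠ lookup v j)}) (to T-allB (to T-allB t i) j)
  ... | inj₁ ≢ = contradiction (fromWitness eq) (to T-not ≢)
  ... | inj₂ i≡j = toWitness i≡j
  bwd : Injective _≡_ _≡_ (lookup v) → T (injectiveB v)
  bwd inj = from T-allB λ i → from T-allB λ j → from T-∨ (case i j)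
    where
    case : ∀ i j → T (not (lookup v i =ᶠ lookup v j)) ⊎ T (i =ᶠ j)
    case i j with lookup v i Fin.≟ lookup v j
    ... | yes eq = inj₂ (fromWitness (inj eq))
    ... | no _ = inj₁ tt

injectiveB-swap : ∀ a (v : Vec (Fin n) n) → injectiveB (swapAt a v) ≡ injectiveB v
injectiveB-swap a v = T-ext (λ t → subst (T ∘ injectiveB) (swapAt-involutive a v) (preserve (swapAt a v) t)) (preserve v)
  where
  preserve : ∀ v → T (injectiveB v) → T (injectiveB (swapAt a v))
  preserve v t = from (T-injectiveB (swapAt a v)) λ {i} {j} eq → adjacent-injective a
    (to (T-injectiveB v) t (trans (sym (adjacent-lookup a v i)) (trans eq (adjacent-lookup a v j))))

module _ {φ : Vec (Fin n) n → Fin n → ℕ} where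

  exchange-adjacent : ∀ a → (∀ v x → φ (swapAt a v) x ≡ φ v x) → ∀ {p q} → toℕ p ≡ a → toℕ q ≡ suc a →
    ∑ᴸ (arrivalOrders n) (λ v → φ v (lookup v p)) ≡ ∑ᴸ (arrivalOrders n) (λ v → φ v (lookup v q))
  exchange-adjacent a φ-swap {p} {q} p≡a q≡1+a = begin
    ∑ᴸ (arrivalOrders n) (λ v → φ v (lookup v p))
      ≡⟨ ∑ᴸ-filter injectiveB (allVecs n n) _ ⟩
    ∑ᴸ (allVecs n n) (λ v → ι (injectiveB v) * φ v (lookup v p))
      ≡⟨ ∑ᴸ-allVecs-swap a n _ ⟩
    ∑ᴸ (allVecs n n) (λ v → ι (injectiveB (swapAt a v)) * φ (swapAt a v) (lookup (swapAt a v) p))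
      ≡⟨ ∑ᴸ-cong (allVecs n n) (λ v _ → cong₂ (λ b → ι b *_) (injectiveB-swap a v)
           (trans (φ-swap v _) (cong (φ v) (lookup-swapAt a v p≡a q≡1+a)))) ⟩
    ∑ᴸ (allVecs n n) (λ v → ι (injectiveB v) * φ v (lookup v q))
      ≡⟨ ∑ᴸ-filter injectiveB (allVecs n n) _ ⟨
    ∑ᴸ (arrivalOrders n) (λ v → φ v (lookup v q)) ∎
    where open ≡-Reasoning

  -- Position `p` is moved to `q` by neighbour swaps that all stay within positions 0 to `i`. So `φ`
  -- need only be invariant under rearranging that prefix, which is all that `improvesPrefix`
  -- offers.
  exchange-≤ : ∀ {i} → (∀ a → a < i → ∀ v x → φ (swapAt a v) x ≡ φ v x) → ∀ {p q} → toℕ q ≤ i → toℕ p ≤ toℕ q →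
    ∑ᴸ (arrivalOrders n) (λ v → φ v (lookup v p)) ≡ ∑ᴸ (arrivalOrders n) (λ v → φ v (lookup v q))
  exchange-≤ {i} φ-swap {p} {q} q≤i p≤q = go (toℕ q ∸ toℕ p) p (ℕ.m∸n+n≡m p≤q)
    where
    go : ∀ d p → d + toℕ p ≡ toℕ q →
      ∑ᴸ (arrivalOrders n) (λ v → φ v (lookup v p)) ≡ ∑ᴸ (arrivalOrders n) (λ v → φ v (lookup v q))
    go zero p p≡q = cong (λ r → ∑ᴸ (arrivalOrders n) (λ v → φ v (lookup v r))) (Fin.toℕ-injective p≡q)
    go (suc d) p eq = trans
      (exchange-adjacent (toℕ p) (φ-swap (toℕ p) (ℕ.<-≤-trans p<q q≤i)) refl (Fin.toℕ-fromℕ< p′<n))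
      (go d (Fin.fromℕ< p′<n) (trans (cong (d +_) (Fin.toℕ-fromℕ< p′<n)) (trans (ℕ.+-suc d (toℕ p)) eq)))
      where
      p<q : toℕ p < toℕ q
      p<q = subst (toℕ p <_) eq (s≤s (ℕ.m≤n+m (toℕ p) d))
      p′<n : suc (toℕ p) < n
      p′<n = ℕ.≤-<-trans p<q (Fin.toℕ<n q)

-- Totals over all arrival orders

sum-below : ∀ {m} (c : ℕ) → m ≤ n → sum {n} (λ p → ι (toℕ p <ᵇ m) * c) ≡ m * c
sum-below {zero} c z≤n = refl
sum-below {suc n} {zero} c _ = sum-below {n} {zero} c z≤n
sum-below {suc n} {suc m} c (s≤s m≤n) = cong₂ _+_ (ℕ.+-identityʳ c) (sum-below c m≤n)

module _ (M : Matroid n) (π : Permutation′ n) where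

  private
    orders = arrivalOrders n
    X = length orders * ∣ OPT M π ∣

    order-injective : ∀ {v} → v List.∈ orders → Injective _≡_ _≡_ (lookup v)
    order-injective {v} v∈ = to (T-injectiveB v) (proj₂ (∈-filter⁻ (T? ∘ injectiveB) {xs = allVecs n n} v∈))

  optAt : Fin n → ℕ
  optAt i = ∑ᴸ orders (λ v → ι (lookup (OPT M π) (lookup v i)))

  improvesAt : Fin n → ℕ
  improvesAt i = ∑ᴸ orders (λ v → ι (improvesPrefix M π (lookup v) (toℕ i) (lookup v i)))

  hits : ℕ
  hits = ∑ᴸ orders (λ v → ∣ OPT M π ∩ ALG algorithm M π zero (lookup v) ∣)

  hits-total : 2 * sum (λ i → ι (afterSample i) * optAt i) ≤ hits + sum (λ i → ι (afterSample i) * improvesAt i)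
  hits-total = begin
    2 * sum (λ i → ι (afterSample i) * optAt i)
      ≡⟨ cong (2 *_) (pull (λ v i → ι (lookup (OPT M π) (lookup v i)))) ⟩
    2 * ∑ᴸ orders (λ v → sum (λ i → ι (afterSample i) * ι (lookup (OPT M π) (lookup v i))))
      ≡⟨ ∑ᴸ-distribˡ-* orders 2 _ ⟨
    ∑ᴸ orders (λ v → 2 * sum (λ i → ι (afterSample i) * ι (lookup (OPT M π) (lookup v i))))
      ≤⟨ ∑ᴸ-mono orders (λ v v∈ → Arrival.hits-bound-by-arrival M π (order-injective v∈)) ⟩
    ∑ᴸ orders (λ v → ∣ OPT M π ∩ ALG algorithm M π zero (lookup v) ∣
                       + sum (λ i → ι (afterSample i) * ι (improvesPrefix M π (lookup v) (toℕ i) (lookup v i))))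
      ≡⟨ ∑ᴸ-distrib-+ orders (λ v → ∣ OPT M π ∩ ALG algorithm M π zero (lookup v) ∣) _ ⟩
    hits + ∑ᴸ orders (λ v → sum (λ i → ι (afterSample i) * ι (improvesPrefix M π (lookup v) (toℕ i) (lookup v i))))
      ≡⟨ cong (hits +_) (pull (λ v i → ι (improvesPrefix M π (lookup v) (toℕ i) (lookup v i)))) ⟨
    hits + sum (λ i → ι (afterSample i) * improvesAt i) ∎
    where
    open ℕ.≤-Reasoning
    pull : ∀ f → sum (λ i → ι (afterSample i) * ∑ᴸ orders (λ v → f v i)) ≡ ∑ᴸ orders (λ v → sum (λ i → ι (afterSample i) * f v i))
    pull f = trans (sum-cong-≗ (λ i → sym (∑ᴸ-distribˡ-* orders (ι (afterSample i)) (λ v → f v i))))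
               (sym (∑ᴸ-sum-comm orders (λ i v → ι (afterSample i) * f v i)))

  optAt-total : sum optAt ≡ X
  optAt-total = trans (sym (∑ᴸ-sum-comm orders (λ i v → ι (lookup (OPT M π) (lookup v i)))))
    (trans (∑ᴸ-cong orders (λ v v∈ → Arrival.OPT-by-arrival M π (order-injective v∈)))
      (∑ᴸ-const orders _))

  optAt-const : ∀ p q → optAt p ≡ optAt q
  optAt-const p q with ℕ.≤-total (toℕ p) (toℕ q)
  ... | inj₁ p≤q = exchange-≤ {φ = λ _ x → ι (lookup (OPT M π) x)} (λ _ _ _ _ → refl) ℕ.≤-refl p≤q
  ... | inj₂ q≤p = sym (exchange-≤ {φ = λ _ x → ι (lookup (OPT M π) x)} (λ _ _ _ _ → refl) ℕ.≤-refl q≤p)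

  improvesPrefix-swap : ∀ {i a} → a < i → ∀ v x →
    improvesPrefix M π (lookup (swapAt a v)) i x ≡ improvesPrefix M π (lookup v) i x
  improvesPrefix-swap {i} {a} a<i v x = T-ext (transfer v′ v (λ {y} → inPrefix-swap′ {y})) (transfer v v′ (λ {y} → inPrefix-swap v {y}))
    where
    v′ = swapAt a v
    inPrefix-swap : ∀ v {y} → T (inPrefix (lookup (swapAt a v)) i y) → T (inPrefix (lookup v) i y)
    inPrefix-swap v {y} t with to T-anyB t
    ... | l , t′ with to (T-∧ {toℕ l <ᵇ suc i}) t′
    ...   | l≤i , vl≡y = from T-anyB (adjacent a l , from T-∧
              ( ℕ.<⇒<ᵇ (s≤s (adjacent-≤ a l a<i (ℕ.s≤s⁻¹ (ℕ.<ᵇ⇒< (toℕ l) (suc i) l≤i))))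
              , fromWitness (trans (sym (adjacent-lookup a v l)) (toWitness vl≡y))))
    inPrefix-swap′ : ∀ {y} → T (inPrefix (lookup v) i y) → T (inPrefix (lookup (swapAt a v)) i y)
    inPrefix-swap′ {y} t = inPrefix-swap v′ (subst (λ u → T (inPrefix (lookup u) i y)) (sym (swapAt-involutive a v)) t)
    transfer : ∀ v v′ → (∀ {y} → T (inPrefix (lookup v′) i y) → T (inPrefix (lookup v) i y)) →
               T (improvesPrefix M π (lookup v) i x) → T (improvesPrefix M π (lookup v′) i x)
    transfer v v′ sub t = from T-unspannedB (Unspanned-antitone
      (λ {y} b → let inp , y≻x = to (T-∧ {inPrefix (lookup v′) i y}) b in from T-∧ (sub inp , y≻x))
      (to T-unspannedB t))

  -- Each of the first i+1 positions is equally likely to carry an improving element of that prefix,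
  -- and a prefix has at most ∣ OPT ∣ of these.
  improvesAt-bound : ∀ i → suc (toℕ i) * improvesAt i ≤ X
  improvesAt-bound i = begin
    suc (toℕ i) * improvesAt i                                        ≡⟨ sum-below {n = n} (improvesAt i) (Fin.toℕ<n i) ⟨
    sum {n} (λ p → ι (toℕ p <ᵇ suc (toℕ i)) * improvesAt i)           ≡⟨ sum-cong-≗ symmetric ⟩
    sum (λ p → ∑ᴸ orders (λ v → ι (toℕ p <ᵇ suc (toℕ i)) * φ v (lookup v p)))
      ≡⟨ ∑ᴸ-sum-comm orders (λ p v → ι (toℕ p <ᵇ suc (toℕ i)) * φ v (lookup v p)) ⟨
    ∑ᴸ orders (λ v → sum (λ p → ι (toℕ p <ᵇ suc (toℕ i)) * φ v (lookup v p)))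
      ≤⟨ ∑ᴸ-mono orders (λ v v∈ → Arrival.prefix-improvers≤∣OPT∣ M π (order-injective v∈) (toℕ i)) ⟩
    ∑ᴸ orders (λ _ → ∣ OPT M π ∣)                                      ≡⟨ ∑ᴸ-const orders _ ⟩
    X                                                                 ∎
    where
    open ℕ.≤-Reasoning
    φ : Vec (Fin n) n → Fin n → ℕ
    φ v x = ι (improvesPrefix M π (lookup v) (toℕ i) x)
    symmetric : ∀ p → ι (toℕ p <ᵇ suc (toℕ i)) * improvesAt i ≡ ∑ᴸ orders (λ v → ι (toℕ p <ᵇ suc (toℕ i)) * φ v (lookup v p))
    symmetric p with toℕ p <ᵇ suc (toℕ i) in eq
    ... | false = sym (trans (∑ᴸ-const orders 0) (ℕ.*-zeroʳ (length orders)))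
    ... | true = trans (cong (1 *_) (sym (exchange-≤ {φ = φ}
            (λ a a<i v x → cong ι (improvesPrefix-swap a<i v x)) {p} {i} ℕ.≤-refl
            (ℕ.s≤s⁻¹ (ℕ.<ᵇ⇒< (toℕ p) _ (subst T (sym eq) tt))))))
            (sym (∑ᴸ-distribˡ-* orders 1 (λ v → φ v (lookup v p))))

-- Harmonic sums and ln 2

fraction : ∀ a b .{{_ : NonZero b}} → ℚ
fraction a b = ℤ.+ a / b

toℚᵘ-fraction : ∀ a b → ℚ.toℚᵘ (fraction a (suc b)) ℚᵘ.≃ mkℚᵘ (ℤ.+ a) b
toℚᵘ-fraction a b = ℚ.toℚᵘ-fromℚᵘ (mkℚᵘ (ℤ.+ a) b)

fraction-≤ : ∀ a b c d .{{_ : NonZero b}} .{{_ : NonZero d}} → a * d ≤ c * b → fraction a b ℚ.≤ fraction c d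
fraction-≤ a (suc b) c (suc d) ad≤cb = ℚ.toℚᵘ-cancel-≤ (begin
  ℚ.toℚᵘ (fraction a (suc b))   ≃⟨ toℚᵘ-fraction a b ⟩
  mkℚᵘ (ℤ.+ a) b                  ≤⟨ ℚᵘ.*≤* (subst₂ ℤ._≤_ (ℤ.pos-* a (suc d)) (ℤ.pos-* c (suc b)) (ℤ.+≤+ ad≤cb)) ⟩
  mkℚᵘ (ℤ.+ c) d                  ≃⟨ toℚᵘ-fraction c d ⟨
  ℚ.toℚᵘ (fraction c (suc d))   ∎)
  where open ℚᵘ.≤-Reasoning

fraction-+ : ∀ a b c d .{{_ : NonZero b}} .{{_ : NonZero d}} →
             fraction a b ℚ.+ fraction c d ≡ fraction (a * d + c * b) (b * d) {{ℕ.m*n≢0 b d}}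
fraction-+ a (suc b) c (suc d) = ℚ.toℚᵘ-injective (begin
  ℚ.toℚᵘ (fraction a (suc b) ℚ.+ fraction c (suc d))                  ≈⟨ ℚ.toℚᵘ-homo-+ (fraction a (suc b)) (fraction c (suc d)) ⟩
  ℚ.toℚᵘ (fraction a (suc b)) ℚᵘ.+ ℚ.toℚᵘ (fraction c (suc d))         ≈⟨ ℚᵘ.+-cong (toℚᵘ-fraction a b) (toℚᵘ-fraction c d) ⟩
  mkℚᵘ (ℤ.+ a) b ℚᵘ.+ mkℚᵘ (ℤ.+ c) d                                      ≡⟨ cong (λ z → mkℚᵘ z (d + b * suc d)) numerator ⟩
  mkℚᵘ (ℤ.+ (a * suc d + c * suc b)) (d + b * suc d)                    ≈⟨ toℚᵘ-fraction _ _ ⟨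
  ℚ.toℚᵘ (fraction (a * suc d + c * suc b) (suc b * suc d))           ∎)
  where
  open import Relation.Binary.Reasoning.Setoid ℚᵘ.≃-setoid
  numerator : (ℤ.+ a ℤ.* ℤ.+ suc d) ℤ.+ (ℤ.+ c ℤ.* ℤ.+ suc b) ≡ ℤ.+ (a * suc d + c * suc b)
  numerator = sym (trans (ℤ.pos-+ (a * suc d) (c * suc b)) (cong₂ ℤ._+_ (ℤ.pos-* a (suc d)) (ℤ.pos-* c (suc b))))

fraction-* : ∀ a b c d .{{_ : NonZero b}} .{{_ : NonZero d}} →
             fraction a b ℚ.* fraction c d ≡ fraction (a * c) (b * d) {{ℕ.m*n≢0 b d}}
fraction-* a (suc b) c (suc d) = ℚ.toℚᵘ-injective (begin
  ℚ.toℚᵘ (fraction a (suc b) ℚ.* fraction c (suc d))                  ≈⟨ ℚ.toℚᵘ-homo-* (fraction a (suc b)) (fraction c (suc d)) ⟩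
  ℚ.toℚᵘ (fraction a (suc b)) ℚᵘ.* ℚ.toℚᵘ (fraction c (suc d))         ≈⟨ ℚᵘ.*-cong (toℚᵘ-fraction a b) (toℚᵘ-fraction c d) ⟩
  mkℚᵘ (ℤ.+ a) b ℚᵘ.* mkℚᵘ (ℤ.+ c) d                                      ≡⟨ cong (λ z → mkℚᵘ z (d + b * suc d)) (ℤ.pos-* a c) ⟨
  mkℚᵘ (ℤ.+ (a * c)) (d + b * suc d)                                    ≈⟨ toℚᵘ-fraction _ _ ⟨
  ℚ.toℚᵘ (fraction (a * c) (suc b * suc d))                           ∎)
  where open import Relation.Binary.Reasoning.Setoid ℚᵘ.≃-setoid

-- Two terms of the binomial expansion. This is the telescoping step that compares the power sum
-- with the integral of x^K from 0 to k.
bernoulli : ∀ k K → suc K * k ^ K + k ^ suc K ≤ suc k ^ suc K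
bernoulli k zero = ℕ.≤-refl
bernoulli k (suc K) = begin
  suc (suc K) * k ^ suc K + k ^ suc (suc K)                          ≤⟨ ℕ.m≤m+n _ (suc K * k ^ K) ⟩
  suc (suc K) * k ^ suc K + k ^ suc (suc K) + suc K * k ^ K          ≡⟨ regroup k K (k ^ K) ⟩
  suc k * (suc K * k ^ K + k ^ suc K)                                ≤⟨ ℕ.*-monoʳ-≤ (suc k) (bernoulli k K) ⟩
  suc k ^ suc (suc K)                                                ∎
  where
  open ℕ.≤-Reasoning
  regroup : ∀ k K p → suc (suc K) * (k * p) + k * (k * p) + suc K * p ≡ suc k * (suc K * p + k * p)
  regroup = solve-∀

-- The powers are summed from the top down so that the recursion over Fin k peels off the largest one.
sum-powers : ∀ k K → suc K * sum {k} (λ j → (k ∸ suc (toℕ j)) ^ K) ≤ k ^ suc K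
sum-powers zero K = ℕ.≤-reflexive (ℕ.*-zeroʳ (suc K))
sum-powers (suc k) K = begin
  suc K * (k ^ K + sum {k} (λ j → (k ∸ suc (toℕ j)) ^ K))           ≡⟨ ℕ.*-distribˡ-+ (suc K) (k ^ K) _ ⟩
  suc K * k ^ K + suc K * sum {k} (λ j → (k ∸ suc (toℕ j)) ^ K)     ≤⟨ ℕ.+-monoʳ-≤ (suc K * k ^ K) (sum-powers k K) ⟩
  suc K * k ^ K + k ^ suc K                                         ≤⟨ bernoulli k K ⟩
  suc k ^ suc K                                                     ∎
  where open ℕ.≤-Reasoning

module _ (k : ℕ) .{{_ : NonZero k}} (F : Fin k → ℕ) (X : ℕ) (F-bound : ∀ j → suc (k + toℕ j) * F j ≤ X) where

  private
    moment powers : ℕ → ℕ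
    moment K = sum (λ j → (k ∸ suc (toℕ j)) ^ K * F j)
    powers K = sum {k} (λ j → (k ∸ suc (toℕ j)) ^ K)

    complement : ∀ j → suc (k + toℕ j) + (k ∸ suc (toℕ j)) ≡ k + k
    complement j = trans (cong (_+ (k ∸ suc (toℕ j))) (sym (ℕ.+-suc k (toℕ j))))
      (trans (ℕ.+-assoc k _ _) (cong (λ z → k + z) (ℕ.m+[n∸m]≡n (Fin.toℕ<n j))))

    weighted : ∀ K → sum (λ j → (k ∸ suc (toℕ j)) ^ K * (suc (k + toℕ j) * F j)) ≤ X * powers K
    weighted K = begin
      sum (λ j → (k ∸ suc (toℕ j)) ^ K * (suc (k + toℕ j) * F j))   ≤⟨ sum-mono (λ j → ℕ.≤-trans (ℕ.*-monoʳ-≤ ((k ∸ suc (toℕ j)) ^ K) (F-bound j)) (ℕ.≤-reflexive (ℕ.*-comm _ X))) ⟩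
      sum {k} (λ j → X * (k ∸ suc (toℕ j)) ^ K)                     ≡⟨ *-distribˡ-sum {k} X (λ j → (k ∸ suc (toℕ j)) ^ K) ⟨
      X * powers K                                                  ∎
      where open ℕ.≤-Reasoning

    -- Write d for `suc (k + toℕ j)` and i for `k ∸ suc (toℕ j)`, so that d + i = 2k. Splitting 2k
    -- this way, the part with d is estimated by `F-bound`, while the part with i keeps `F j` itself
    -- and so can be expanded again.
    moment-step : ∀ K → (k + k) * moment K ≤ X * powers K + moment (suc K)
    moment-step K = begin
      (k + k) * moment K                                            ≡⟨ *-distribˡ-sum (k + k) (λ j → (k ∸ suc (toℕ j)) ^ K * F j) ⟩
      sum (λ j → (k + k) * ((k ∸ suc (toℕ j)) ^ K * F j))           ≡⟨ sum-cong-≗ (λ j → trans (cong (_* ((k ∸ suc (toℕ j)) ^ K * F j)) (sym (complement j)))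
                                                                        (regroup (suc (k + toℕ j)) (k ∸ suc (toℕ j)) ((k ∸ suc (toℕ j)) ^ K) (F j))) ⟩
      sum (λ j → (k ∸ suc (toℕ j)) ^ K * (suc (k + toℕ j) * F j) + (k ∸ suc (toℕ j)) ^ suc K * F j)
                                                                    ≡⟨ ∑-distrib-+ (λ j → (k ∸ suc (toℕ j)) ^ K * (suc (k + toℕ j) * F j)) _ ⟩
      sum (λ j → (k ∸ suc (toℕ j)) ^ K * (suc (k + toℕ j) * F j)) + moment (suc K)
                                                                    ≤⟨ ℕ.+-monoˡ-≤ (moment (suc K)) (weighted K) ⟩
      X * powers K + moment (suc K)                                 ∎
      where
      open ℕ.≤-Reasoning
      regroup : ∀ d i p f → (d + i) * (p * f) ≡ p * (d * f) + i * p * f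
      regroup = solve-∀

    -- The remainder after stopping the expansion needs only the crude estimate d ≥ k in place of d
    -- + i = 2k. The factor 2 lost is the one between the tail bound 1/((K+1) 2^K) and the term
    -- 1/((K+1) 2^(K+1)).
    moment-bound : ∀ K → suc K * moment K ≤ X * k ^ K
    moment-bound K = ℕ.*-cancelˡ-≤ k (begin
      k * (suc K * moment K)                                        ≡⟨ swap k (suc K) (moment K) ⟩
      suc K * (k * moment K)                                        ≡⟨ cong (suc K *_) (*-distribˡ-sum k (λ j → (k ∸ suc (toℕ j)) ^ K * F j)) ⟩
      suc K * sum (λ j → k * ((k ∸ suc (toℕ j)) ^ K * F j))         ≤⟨ ℕ.*-monoʳ-≤ (suc K) (ℕ.≤-trans (sum-mono (λ j → enlarge j)) (weighted K)) ⟩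
      suc K * (X * powers K)                                        ≡⟨ swap (suc K) X (powers K) ⟩
      X * (suc K * powers K)                                        ≤⟨ ℕ.*-monoʳ-≤ X (sum-powers k K) ⟩
      X * (k * k ^ K)                                               ≡⟨ swap X k (k ^ K) ⟩
      k * (X * k ^ K)                                               ∎)
      where
      open ℕ.≤-Reasoning
      swap : ∀ a b c → a * (b * c) ≡ b * (a * c)
      swap = solve-∀
      enlarge : ∀ j → k * ((k ∸ suc (toℕ j)) ^ K * F j) ≤ (k ∸ suc (toℕ j)) ^ K * (suc (k + toℕ j) * F j)
      enlarge j = ℕ.≤-trans (ℕ.≤-reflexive (swap k ((k ∸ suc (toℕ j)) ^ K) (F j)))
        (ℕ.*-monoʳ-≤ ((k ∸ suc (toℕ j)) ^ K) (ℕ.*-monoˡ-≤ (F j) (ℕ.m≤n⇒m≤1+n (ℕ.m≤m+n k (toℕ j)))))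

    -- This is (2k)^K, kept factored: `k ^ K` cancels against the power sums and `2 ^ K` remains as
    -- the denominator in the series for ln 2.
    scale : ℕ → ℕ
    scale K = 2 ^ K * k ^ K

    scale≢0 : ∀ K → NonZero (scale K)
    scale≢0 K = ℕ.m*n≢0 (2 ^ K) (k ^ K) {{ℕ.m^n≢0 2 K}} {{ℕ.m^n≢0 k K}}

    scaledMoment : ℕ → ℚ
    scaledMoment K = fraction (moment K) (scale K) {{scale≢0 K}}

    scaledMoment-step : ∀ K → scaledMoment K ℚ.≤ fraction X 1 ℚ.* lnTwoTerm K ℚ.+ scaledMoment (suc K)
    scaledMoment-step K = subst (scaledMoment K ℚ.≤_) (sym combined)
      (fraction-≤ (moment K) (scale K) (X * 1 * b′ + moment (suc K) * (1 * c)) (1 * c * b′) {{scale≢0 K}} {{ℕ.m*n≢0 (1 * c) b′ {{ℕ.m*n≢0 1 c}}}} cleared)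
      where
      b = scale K
      b′ = scale (suc K)
      c = suc K * 2 ^ suc K
      instance
        c≢0 : NonZero c
        c≢0 = ℕ.m*n≢0 (suc K) (2 ^ suc K) {{_}} {{ℕ.m^n≢0 2 (suc K)}}
        b′≢0 : NonZero b′
        b′≢0 = scale≢0 (suc K)
      combined : fraction X 1 ℚ.* lnTwoTerm K ℚ.+ scaledMoment (suc K) ≡
                 fraction (X * 1 * b′ + moment (suc K) * (1 * c)) (1 * c * b′) {{ℕ.m*n≢0 (1 * c) b′ {{ℕ.m*n≢0 1 c}}}}
      combined = trans (cong (ℚ._+ scaledMoment (suc K)) (fraction-* X 1 1 c))
                   (fraction-+ (X * 1) (1 * c) (moment (suc K)) b′ {{ℕ.m*n≢0 1 c}})
      expand : ∀ m s t p k b → m * (1 * (s * (2 * t)) * (2 * t * (k * p))) ≡ 2 * t * s * ((k + k) * m) * (t * p)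
      expand = solve-∀
      collect : ∀ s t X P m′ → 2 * t * s * (X * P + m′) ≡ X * (2 * t) * (s * P) + m′ * (s * (2 * t))
      collect = solve-∀
      final : ∀ X t q m′ c → X * t * q + m′ * c ≡ X * 1 * (t * q) + m′ * (1 * c)
      final = solve-∀
      cleared : moment K * (1 * c * b′) ≤ (X * 1 * b′ + moment (suc K) * (1 * c)) * b
      cleared = begin
        moment K * (1 * c * b′)                                       ≡⟨ expand (moment K) (suc K) (2 ^ K) (k ^ K) k b ⟩
        2 ^ suc K * suc K * ((k + k) * moment K) * b                  ≤⟨ ℕ.*-monoˡ-≤ b (ℕ.*-monoʳ-≤ (2 ^ suc K * suc K) (moment-step K)) ⟩
        2 ^ suc K * suc K * (X * powers K + moment (suc K)) * b       ≡⟨ cong (_* b) (collect (suc K) (2 ^ K) X (powers K) (moment (suc K))) ⟩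
        (X * 2 ^ suc K * (suc K * powers K) + moment (suc K) * c) * b
          ≤⟨ ℕ.*-monoˡ-≤ b (ℕ.+-monoˡ-≤ (moment (suc K) * c) (ℕ.*-monoʳ-≤ (X * 2 ^ suc K) (sum-powers k K))) ⟩
        (X * 2 ^ suc K * k ^ suc K + moment (suc K) * c) * b          ≡⟨ cong (_* b) (final X (2 ^ suc K) (k ^ suc K) (moment (suc K)) c) ⟩
        (X * 1 * b′ + moment (suc K) * (1 * c)) * b                   ∎
        where open ℕ.≤-Reasoning

    scaledMoment-bound : ∀ K → scaledMoment K ℚ.≤ fraction X 1 ℚ.* fraction 1 (suc K * 2 ^ K) {{ℕ.m*n≢0 (suc K) (2 ^ K) {{_}} {{ℕ.m^n≢0 2 K}}}}
    scaledMoment-bound K = subst (scaledMoment K ℚ.≤_) (sym (fraction-* X 1 1 c))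
      (fraction-≤ (moment K) (scale K) (X * 1) (1 * c) {{scale≢0 K}} {{ℕ.m*n≢0 1 c}} (begin
        moment K * (1 * c)            ≡⟨ expand (moment K) (suc K) (2 ^ K) ⟩
        2 ^ K * (suc K * moment K)    ≤⟨ ℕ.*-monoʳ-≤ (2 ^ K) (moment-bound K) ⟩
        2 ^ K * (X * k ^ K)           ≡⟨ collect X (2 ^ K) (k ^ K) ⟩
        X * 1 * (2 ^ K * k ^ K)       ∎))
      where
      open ℕ.≤-Reasoning
      c = suc K * 2 ^ K
      instance
        c≢0 : NonZero c
        c≢0 = ℕ.m*n≢0 (suc K) (2 ^ K) {{_}} {{ℕ.m^n≢0 2 K}}
      expand : ∀ m s t → m * (1 * (s * t)) ≡ t * (s * m)
      expand = solve-∀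
      collect : ∀ X t q → t * (X * q) ≡ X * 1 * (t * q)
      collect = solve-∀

    partial-bound : ∀ K → fraction (sum F) 1 ℚ.≤ fraction X 1 ℚ.* lnTwoPartial K ℚ.+ scaledMoment K
    partial-bound zero = ℚ.≤-trans
      (fraction-≤ (sum F) 1 (moment 0) (scale 0) {{_}} {{scale≢0 0}} (ℕ.≤-reflexive (cong (_* 1) (sum-cong-≗ λ j → sym (ℕ.+-identityʳ (F j))))))
      (ℚ.≤-reflexive (trans (sym (ℚ.+-identityˡ (scaledMoment 0))) (cong (ℚ._+ scaledMoment 0) (sym (ℚ.*-zeroʳ (fraction X 1))))))
    partial-bound (suc K) = begin
      fraction (sum F) 1                                                       ≤⟨ partial-bound K ⟩
      x ℚ.* lnTwoPartial K ℚ.+ scaledMoment K                                  ≤⟨ ℚ.+-monoʳ-≤ (x ℚ.* lnTwoPartial K) (scaledMoment-step K) ⟩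
      x ℚ.* lnTwoPartial K ℚ.+ (x ℚ.* lnTwoTerm K ℚ.+ scaledMoment (suc K))    ≡⟨ ℚ.+-assoc (x ℚ.* lnTwoPartial K) _ _ ⟨
      x ℚ.* lnTwoPartial K ℚ.+ x ℚ.* lnTwoTerm K ℚ.+ scaledMoment (suc K)      ≡⟨ cong (ℚ._+ scaledMoment (suc K)) (ℚ.*-distribˡ-+ x (lnTwoPartial K) (lnTwoTerm K)) ⟨
      x ℚ.* lnTwoPartial (suc K) ℚ.+ scaledMoment (suc K)                      ∎
      where
      open ℚ.≤-Reasoning
      x = fraction X 1

  sum-≤-lnTwoUpper : ∀ K → fraction (sum F) 1 ℚ.≤ fraction X 1 ℚ.* lnTwoUpper K
  sum-≤-lnTwoUpper K = ℚ.≤-trans (partial-bound K) (ℚ.≤-trans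
    (ℚ.+-monoʳ-≤ (fraction X 1 ℚ.* lnTwoPartial K) (scaledMoment-bound K))
    (ℚ.≤-reflexive (sym (ℚ.*-distribˡ-+ (fraction X 1) (lnTwoPartial K) _))))

harmonic-bound : ∀ k (F : Fin k → ℕ) X → (∀ j → suc (k + toℕ j) * F j ≤ X) → ∀ K →
                 fraction (sum F) 1 ℚ.≤ fraction X 1 ℚ.* lnTwoUpper K
-- The empty sum still requires a nonnegative right-hand side, and a single zero entry at k = 1
-- supplies it.
harmonic-bound zero _ X _ = sum-≤-lnTwoUpper 1 (λ _ → 0) X (λ { zero → z≤n })
harmonic-bound (suc k) F X F-bound = sum-≤-lnTwoUpper (suc k) F X F-bound

-- Even and odd n, and the final ratio

sum-split : ∀ a {b} (F : Fin (a + b) → ℕ) → sum F ≡ sum (λ i → F (i ↑ˡ b)) + sum (λ j → F (a ↑ʳ j))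
sum-split zero F = refl
sum-split (suc a) F = trans (cong (λ z → F zero + z) (sum-split a (F ∘ suc))) (sym (ℕ.+-assoc (F zero) _ _))

sum-late : ∀ a {b} (F : Fin (a + b) → ℕ) → sum (λ i → ι (not (toℕ i <ᵇ a)) * F i) ≡ sum (λ j → F (a ↑ʳ j))
sum-late zero F = sum-cong-≗ (λ j → ℕ.+-identityʳ (F j))
sum-late (suc a) F = sum-late a (F ∘ suc)

sum-const : ∀ {n} {f : Fin n → ℕ} {c} → (∀ i → f i ≡ c) → sum f ≡ n * c
sum-const {zero} _ = refl
sum-const {suc n} f≡c = cong₂ _+_ (f≡c zero) (sum-const (f≡c ∘ suc))

halve : ∀ n → ∃[ k ] (n ≡ k + k ⊎ n ≡ k + suc k)
halve zero = 0 , inj₁ refl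
halve (suc n) with halve n
... | k , inj₁ n≡k+k = k , inj₂ (trans (cong suc n≡k+k) (sym (ℕ.+-suc k k)))
... | k , inj₂ n≡k+1+k = suc k , inj₁ (cong suc n≡k+1+k)

-- Both parities reduce to the same k harmonic terms. For n = 2k the late half carries exactly half
-- of `X`. For n = 2k + 1 there are k + 1 late positions, each carrying o = X / n, so twice their
-- total is X + o. The surplus o absorbs the last improving term, which is at most X / n, and `G`
-- consists of the other k terms.
late-half : ∀ {n k} → n ≡ k + k ⊎ n ≡ k + suc k → {O F : Fin n → ℕ} {X H : ℕ} →
            sum O ≡ X → (∀ p q → O p ≡ O q) → (∀ i → suc (toℕ i) * F i ≤ X) →
            2 * sum (λ i → ι (afterSample i) * O i) ≤ H + sum (λ i → ι (afterSample i) * F i) →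
            ∃[ G ] ((∀ j → suc (k + toℕ j) * G j ≤ X) × X ≤ H + sum {k} G)
late-half {k = k} (inj₁ refl) {O} {F} {X} {H} ∑O≡X O-const F-bound total
  = (λ j → F (k ↑ʳ j)) , (λ j → subst (λ i → suc i * F (k ↑ʳ j) ≤ X) (Fin.toℕ-↑ʳ k j) (F-bound (k ↑ʳ j))) , (begin
    X                                               ≡⟨ ∑O≡X ⟨
    sum O                                           ≡⟨ sum-split k O ⟩
    sum (λ i → O (i ↑ˡ k)) + sum (λ j → O (k ↑ʳ j)) ≡⟨ cong₂ _+_ (sum-cong-≗ λ i → O-const (i ↑ˡ k) (k ↑ʳ i)) (sym (ℕ.+-identityʳ _)) ⟩
    2 * sum (λ j → O (k ↑ʳ j))                      ≡⟨ cong (2 *_) (late O) ⟨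
    2 * sum (λ i → ι (afterSample i) * O i)            ≤⟨ total ⟩
    H + sum (λ i → ι (afterSample i) * F i)            ≡⟨ cong (λ z → H + z) (late F) ⟩
    H + sum (λ j → F (k ↑ʳ j))                      ∎)
  where
  open ℕ.≤-Reasoning
  late : ∀ f → sum (λ i → ι (afterSample i) * f i) ≡ sum (λ j → f (k ↑ʳ j))
  late f = trans (cong (λ h → sum (λ i → ι (not (toℕ i <ᵇ h)) * f i)) (sym (ℕ.n≡⌊n+n/2⌋ k))) (sum-late k f)
late-half {k = k} (inj₂ refl) {O} {F} {X} {H} ∑O≡X O-const F-bound total
  = G , (λ j → subst (λ i → suc i * G j ≤ X) (trans (Fin.toℕ-↑ʳ k (Fin.inject₁ j)) (cong (λ z → k + z) (Fin.toℕ-inject₁ j))) (F-bound (k ↑ʳ Fin.inject₁ j)))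
      , ℕ.+-cancelʳ-≤ o X (H + sum G) (begin
    X + o                                           ≡⟨ cong (_+ o) X≡ ⟩
    (k + suc k) * o + o                             ≡⟨ double k o ⟩
    2 * (suc k * o)                                 ≡⟨ cong (2 *_) (trans (late O) (sum-const λ j → O-const (k ↑ʳ j) end)) ⟨
    2 * sum (λ i → ι (afterSample i) * O i)            ≤⟨ total ⟩
    H + sum (λ i → ι (afterSample i) * F i)            ≡⟨ cong (λ z → H + z) (trans (late F) (sum-init-last (λ j → F (k ↑ʳ j)))) ⟩
    H + (sum G + F end)                             ≤⟨ ℕ.+-monoʳ-≤ H (ℕ.+-monoʳ-≤ (sum G) F-end) ⟩
    H + (sum G + o)                                 ≡⟨ ℕ.+-assoc H (sum G) o ⟨
    H + sum G + o                                   ∎)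
  where
  open ℕ.≤-Reasoning
  end : Fin (k + suc k)
  end = k ↑ʳ Fin.fromℕ k
  o = O end
  G : Fin k → ℕ
  G j = F (k ↑ʳ Fin.inject₁ j)
  late : ∀ f → sum (λ i → ι (afterSample i) * f i) ≡ sum (λ j → f (k ↑ʳ j))
  late f = trans (cong (λ h → sum (λ i → ι (not (toℕ i <ᵇ h)) * f i)) (sym (trans (ℕ.n≡⌈n+n/2⌉ k) (cong ⌊_/2⌋ (sym (ℕ.+-suc k k)))))) (sum-late k f)
  X≡ : X ≡ (k + suc k) * o
  X≡ = trans (sym ∑O≡X) (sum-const λ i → O-const i end)
  double : ∀ k o → (k + suc k) * o + o ≡ 2 * (suc k * o)
  double = solve-∀
  end≡ : suc (toℕ end) ≡ k + suc k
  end≡ = trans (cong suc (trans (Fin.toℕ-↑ʳ k (Fin.fromℕ k)) (cong (λ z → k + z) (Fin.toℕ-fromℕ k)))) (sym (ℕ.+-suc k k))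
  F-end : F end ≤ o
  F-end = ℕ.*-cancelˡ-≤ (suc (toℕ end)) (ℕ.≤-trans (F-bound end) (ℕ.≤-reflexive (trans X≡ (cong (_* o) (sym end≡)))))

cancel-upper : ∀ x h u s → x ℚ.≤ h ℚ.+ s → s ℚ.≤ x ℚ.* u → (1ℚ ℚ.- u) ℚ.* x ℚ.≤ h
cancel-upper x h u s x≤h+s s≤xu = begin
  (1ℚ ℚ.- u) ℚ.* x                       ≡⟨ ℚ.*-distribʳ-+ x 1ℚ (ℚ.- u) ⟩
  1ℚ ℚ.* x ℚ.+ (ℚ.- u) ℚ.* x             ≡⟨ cong₂ ℚ._+_ (ℚ.*-identityˡ x) (trans (sym (ℚ.neg-distribˡ-* u x)) (cong ℚ.-_ (ℚ.*-comm u x))) ⟩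
  x ℚ.- x ℚ.* u                          ≤⟨ ℚ.+-monoˡ-≤ (ℚ.- (x ℚ.* u)) (ℚ.≤-trans x≤h+s (ℚ.+-monoʳ-≤ h s≤xu)) ⟩
  h ℚ.+ x ℚ.* u ℚ.- x ℚ.* u              ≡⟨ ℚ.+-assoc h _ _ ⟩
  h ℚ.+ (x ℚ.* u ℚ.- x ℚ.* u)            ≡⟨ cong (h ℚ.+_) (ℚ.+-inverseʳ (x ℚ.* u)) ⟩
  h ℚ.+ 0ℚ                               ≡⟨ ℚ.+-identityʳ h ⟩
  h                                      ∎
  where open ℚ.≤-Reasoning

fraction-+-whole : ∀ a b → fraction (a + b) 1 ≡ fraction a 1 ℚ.+ fraction b 1
fraction-+-whole a b = sym (trans (fraction-+ a 1 b 1) (cong (λ c → fraction c 1) (cong₂ _+_ (ℕ.*-identityʳ a) (ℕ.*-identityʳ b))))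

ratio-bound : ∀ {k X H} → ∃[ G ] ((∀ j → suc (k + toℕ j) * G j ≤ X) × X ≤ H + sum {k} G) → ∀ K →
              (1ℚ ℚ.- lnTwoUpper K) ℚ.* fraction X 1 ℚ.≤ fraction H 1
ratio-bound {k} {X} {H} (G , G-bound , X≤) K =
  cancel-upper (fraction X 1) (fraction H 1) (lnTwoUpper K) (fraction (sum G) 1)
    (subst (fraction X 1 ℚ.≤_) (fraction-+-whole H (sum G)) (fraction-≤ X 1 (H + sum G) 1 (ℕ.*-monoˡ-≤ 1 X≤)))
    (harmonic-bound k G X G-bound K)

module _ (M : Matroid n) (π : Permutation′ n) where

  late-half-hits : ∃[ k ] ∃[ G ] ((∀ j → suc (k + toℕ j) * G j ≤ length (arrivalOrders n) * ∣ OPT M π ∣)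
                                   × length (arrivalOrders n) * ∣ OPT M π ∣ ≤ hits M π + sum {k} G)
  late-half-hits = proj₁ (halve n) ,
    late-half (proj₂ (halve n)) (optAt-total M π) (optAt-const M π) (improvesAt-bound M π) (hits-total M π)

  sampleSize≡ : sampleSize algorithm n * ∣ OPT M π ∣ ≡ length (arrivalOrders n) * ∣ OPT M π ∣
  sampleSize≡ = cong (_* ∣ OPT M π ∣) (ℕ.+-identityʳ (length (arrivalOrders n)))

  totalHits≡ : totalHits algorithm M π ≡ hits M π
  totalHits≡ = ℕ.+-identityʳ (hits M π)

competitive : ∀ n (M : Matroid n) (π : Permutation′ n) K →
  (1ℚ ℚ.- lnTwoUpper K) ℚ.* fraction (sampleSize algorithm n * ∣ OPT M π ∣) 1 ℚ.≤ fraction (totalHits algorithm M π) 1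
competitive n M π K = subst₂ (λ X H → (1ℚ ℚ.- lnTwoUpper K) ℚ.* fraction X 1 ℚ.≤ fraction H 1)
  (sym (sampleSize≡ M π)) (sym (totalHits≡ M π)) (ratio-bound (proj₂ (late-half-hits M π)) K)

open import Data.Integer using (+_)
open import Data.Rational using (_-_) renaming (_≤_ to _≤ℚ_; _*_ to _*ℚ_)

theorem1 : ∃[ A ] (Feasible A ×
    (∀ (n : ℕ) (M : Matroid n) (π : Permutation′ n) (K : ℕ) →
    (1ℚ - lnTwoUpper K) *ℚ (+ (sampleSize A n * ∣ OPT M π ∣) / 1)
    ≤ℚ (+ totalHits A M π / 1)))
theorem1 = algorithm , feasible , competitive
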